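{- Let $r \ge 2$, $k \ge 1$ and $n \ge 1$ be integers and let $\mathbf{s} = (s_1, \dots, s_n)$ be a vector of positive integers with $s_i \in [b(r)-1]$. Then $\chi(\mathrm{KG}^r_{\mathbf{s}}(n,k)) \ge \left\lceil \frac{(\sum_i s_i)-r(k-1)}{r-1} \right\rceil$. In particular, for an integer $s$ with $s-1\in[b(r)-1]$, $\chi(\mathrm{KG}^r_{s-1}(n,k)) \ge \left\lceil \frac{(s-1)n-r(k-1)}{r-1} \right\rceil$.
   Context: For an integer $r\ge2$ with prime factorization $r=2^{\alpha_0}p_1^{\alpha_1}\cdots p_t^{\alpha_t}$ ($p_i$ pairwise distinct odd primes, $\alpha_i\ge0$), $b(r)=2^{\alpha_0}(p_1-1)^{\alpha_1}\cdots(p_t-1)^{\alpha_t}$. For a hypergraph $H$ (a set of hyperedges, each a multisubset of the vertex set), an $m$-coloring is a map from the vertices to $[m]$ such that no hyperedge is monochromatic; $\chi(H)$ is the least such $m$. $\mathrm{KG}^r_{\mathbf{s}}(n,k)$ is the hypergraph on vertex set $\binom{[n]}{k}$ (the $k$-element subsets of $[n]$) in which a multisubset $\{\{A_1,\dots,A_r\}\}$ is a hyperedge iff each $i\in[n]$ is contained in at most $s_i$ of the sets $A_1,\dots,A_r$ (counted with multiplicity). $\mathrm{KG}^r_{s-1}(n,k)$ denotes $\mathrm{KG}^r_{(s-1,\dots,s-1)}(n,k)$, i.e., $\{\{A_1,\dots,A_r\}\}$ is a hyperedge iff $A_{i_1}\cap\dots\cap A_{i_s}=\emptyset$ for all pairwise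 distinct $i_1,\dots,i_s\in[r]$. -}

module Defs where

open import Data.Nat using (ℕ; zero; suc; _+_; _*_; _∸_; _^_; _/_; _≤_; _≟_)
open import Data.Nat.Divisibility using (_∣?_)
open import Data.Nat.Primality using (prime?)
open import Data.Bool using (Bool; true; false; if_then_else_)
open import Data.List using (List; upTo; map)
open import Data.Nat.ListAction using (product)
open import Data.Fin using (Fin; zero; suc)
open import Data.Vec using (Vec; lookup)
open import Data.Fin.Subset using (Subset; ∣_∣)
open import Data.Product using (Σ; _×_)
open import Relation.Nullary using (¬_; does; yes; no)
open import Relation.Binary.PropositionalEquality using (_≡_)

-- multiplicity of p in m (using fuel); only meaningful for p ≥ 2, m ≥ 1
mult : (fuel p m : ℕ) → ℕ
mult zero _ _ = 0
mult (suc f) (suc (suc q)) (suc m) with suc (suc q) ∣? suc m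
... | yes _ = suc (mult f (suc (suc q)) (suc m / suc (suc q)))
... | no _  = 0
mult (suc f) _ _ = 0

primeWeight : ℕ → ℕ
primeWeight p = if does (p ≟ 2) then 2 else p ∸ 1

b : ℕ → ℕ
b r = product (map (λ p → if does (prime? p) then primeWeight p ^ mult r p r else 1)
                   (upTo (suc r)))

Vertex : ℕ → ℕ → Set
Vertex n k = Σ (Subset n) (λ A → ∣ A ∣ ≡ k)

countTrue : (r : ℕ) → (Fin r → Bool) → ℕ
countTrue zero f = 0
countTrue (suc r) f = (if f zero then 1 else 0) + countTrue r (λ j → f (suc j))

-- a multiset {{A_1..A_r}} of vertices, given as an r-tuple, is a hyperedge of KG^r_s(n,k)
-- iff each i ∈ [n] lies in at most s_i of the A_j (with multiplicity)
IsHyperedge : (r n k : ℕ) → (s : Fin n → ℕ) → (Fin r → Vertex n k) → Set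
IsHyperedge r n k s A = (i : Fin n) → countTrue r (λ j → lookup (Σ.proj₁ (A j)) i) ≤ s i

IsProperColoring : (r n k : ℕ) → (s : Fin n → ℕ) → (m : ℕ) → (Vertex n k → Fin m) → Set
IsProperColoring r n k s m c =
  (A : Fin r → Vertex n k) → IsHyperedge r n k s A →
    ¬ ((j j′ : Fin r) → c (A j) ≡ c (A j′))

ChromaticAtLeast : (r n k : ℕ) → (s : Fin n → ℕ) → ℕ → Set
ChromaticAtLeast r n k s t =
  (m : ℕ) → (c : Vertex n k → Fin m) → IsProperColoring r n k s m c → t ≤ m

ceilDiv : ℕ → ℕ → ℕ
ceilDiv a zero = 0
ceilDiv a (suc d) = (a + d) / suc d

sumFin : (n : ℕ) → (Fin n → ℕ) → ℕ
sumFin zero f = 0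
sumFin (suc n) f = f zero + sumFin n (λ i → f (suc i))

{-# OPTIONS --safe #-}
module Submission where

-- The bound is proved whenever s i ≤ r, which covers the theorem since b r ≤ r and
-- which is what makes the induction over the factors of r work.
--
-- For prime r = p and s i < p, replace i by s i copies. An assignment X of signs
-- in ℤ/p to some of the N = Σ s i copies determines the sets
-- A_g(X) = { i | a copy of i has sign g }. If all of them have fewer than k
-- elements, the level of X is Σ |A_g(X)|; otherwise it is p (k - 1) plus the
-- number of pairs (c , g) such that A_g(X) contains a k-set of colour c. If no
-- hyperedge is monochromatic, there are at most p (k - 1) + (p - 1) m < N levels,
-- and an equivariant choice from the subsets of ℤ/p involved gives signs which
-- agree on comparable X of equal level. This is an equivariant simplicial map from
-- the subdivided N-fold join of ℤ/p to a join of fewer copies, hence a self-map of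
-- the N-fold join which vanishes on top-dimensional chains. Its Lefschetz number
-- (with the empty cell included) is 0 by acyclicity, but it is ±1 modulo p, because
-- only the empty cell is fixed by the group.
--
-- For composite r = r₂ r₁, replace i by r₁ copies of multiplicities at most r₂
-- and combine the bounds for r₁ and r₂.

open import Defs
open import Data.Nat.Base as ℕ using (ℕ; zero; suc)
import Data.Nat.Properties as ℕ
open import Data.Fin.Base using (Fin; zero; suc; toℕ; fromℕ; fromℕ<; inject₁; splitAt; _↑ˡ_; _↑ʳ_; combine; remQuot)
open import Data.Fin.Properties as Fin using (any?; all?)
open import Data.Fin.Relation.Unary.Top using (view; ‵fromℕ; ‵inject₁)
open import Data.Maybe.Base as Maybe using (Maybe; just; nothing)
import Data.Maybe.Properties as Maybe
open import Data.Vec.Base as Vec using (Vec; []; _∷_; lookup; tabulate)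
open import Data.Product using (Σ; ∃; ∃₂; _×_; _,_; proj₁; proj₂)
open import Data.Sum using (_⊎_; inj₁; inj₂)
open import Data.Empty using (⊥; ⊥-elim)
open import Function.Base using (_∘_)
open import Function.Bundles using (_⇔_; mk⇔; Equivalence)
open import Relation.Nullary using (¬_; Dec; yes; no; does)
open import Relation.Nullary.Decidable using (_×-dec_; _→-dec_; _⊎-dec_; map′; dec-true; does-⇔)
open import Relation.Unary using (Decidable)
open import Relation.Binary.PropositionalEquality

-- Rotation of a cyclic group

-- The generator subtracts one modulo suc q.
ω : ∀ {q} → Fin (suc q) → Fin (suc q)
ω {q} zero = fromℕ q
ω (suc i)  = inject₁ i

ω-injective : ∀ {q} {i j : Fin (suc q)} → ω i ≡ ω j → i ≡ j
ω-injective {i = zero}  {zero}  eq = refl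
ω-injective {i = zero}  {suc j} eq = ⊥-elim (Fin.fromℕ≢inject₁ eq)
ω-injective {i = suc i} {zero}  eq = ⊥-elim (Fin.fromℕ≢inject₁ (sym eq))
ω-injective {i = suc i} {suc j} eq = cong suc (Fin.inject₁-injective eq)

-- At `suc i`, invariance compares neighbouring values, because `ω (suc i)` is `inject₁ i`.
ω-constant : ∀ {A : Set} {q} (f : Fin (suc q) → A) → (∀ i → f (ω i) ≡ f i) → ∀ i → f i ≡ f zero
ω-constant f h = go f (h ∘ suc)
  where
  go : ∀ {A : Set} {q} (f : Fin (suc q) → A) → (∀ i → f (inject₁ i) ≡ f (suc i)) → ∀ i → f i ≡ f zero
  go             f h zero    = refl
  go {q = suc q} f h (suc i) = trans (go (f ∘ suc) (h ∘ suc) i) (sym (h zero))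

ω-surjective : ∀ {q} (j : Fin (suc q)) → ∃ λ i → ω i ≡ j
ω-surjective j with view j
... | ‵fromℕ     = zero , refl
... | ‵inject₁ i = suc i , refl

module EquivariantLabelling where

  open import Data.Integer.Base as ℤ using (ℤ; 0ℤ; 1ℤ; _+_; _-_; _*_; -_)
  import Data.Integer.Properties as ℤ
  open import Data.Integer.Tactic.RingSolver using (solve-∀)
  open import Algebra.Properties.AbelianGroup ℤ.+-0-abelianGroup using (identityʳ-unique)
  open import Algebra.Properties.CommutativeMonoid.Sum ℤ.+-0-commutativeMonoid using (sum; sum-cong-≗; ∑-distrib-+; sum-replicate-zero; sum-init-last)

  -- Finite sums and linear operators over the integers

  sum-zero : ∀ {n} (f : Fin n → ℤ) → (∀ i → f i ≡ 0ℤ) → sum f ≡ 0ℤ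
  sum-zero {n} f f≡0 = trans (sum-cong-≗ f≡0) (sum-replicate-zero n)

  sum-neg : ∀ {n} (f : Fin n → ℤ) → sum (λ i → - f i) ≡ - sum f
  sum-neg {zero}  f = refl
  sum-neg {suc n} f = trans (cong ((- f zero) +_) (sum-neg (f ∘ suc))) (sym (ℤ.neg-distrib-+ (f zero) _))

  sum-single : ∀ {n} (f : Fin n → ℤ) k → (∀ i → i ≢ k → f i ≡ 0ℤ) → sum f ≡ f k
  sum-single f zero    h = trans (cong (f zero +_) (sum-zero (f ∘ suc) λ i → h (suc i) λ ())) (ℤ.+-identityʳ _)
  sum-single f (suc k) h = trans (cong₂ _+_ (h zero λ ()) (sum-single (f ∘ suc) k λ i i≢k → h (suc i) (i≢k ∘ Fin.suc-injective)))
                                 (ℤ.+-identityˡ _)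

  sum-const : ∀ {n} (f : Fin n → ℤ) x → (∀ i → f i ≡ x) → sum f ≡ ℤ.+ n * x
  sum-const {zero}  f x h = sym (ℤ.*-zeroˡ x)
  sum-const {suc n} f x h = trans (cong₂ _+_ (h zero) (sum-const (f ∘ suc) x (h ∘ suc))) (sym (ℤ.suc-* (ℤ.+ n) x))

  interchange : ∀ a b c d → (a + b) + (c + d) ≡ (a + c) + (b + d)
  interchange = solve-∀

  idempotent⇒0 : ∀ x → x ≡ x + x → x ≡ 0ℤ
  idempotent⇒0 x x≡x+x = identityʳ-unique x x (sym x≡x+x)

  -- Functions on cells are compared pointwise, so congruence is a field `ext` of its own. Zero,
  -- subtraction and finite sums follow from `add` and `neg`.
  record IsLinear {A B : Set} (L : (A → ℤ) → B → ℤ) : Set where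
    field
      ext : ∀ {f g} → (∀ a → f a ≡ g a) → ∀ b → L f b ≡ L g b
      add : ∀ f g b → L (λ a → f a + g a) b ≡ L f b + L g b
      neg : ∀ f b → L (λ a → - f a) b ≡ - L f b

    sub : ∀ f g b → L (λ a → f a - g a) b ≡ L f b - L g b
    sub f g b = trans (add f (λ a → - g a) b) (cong (L f b +_) (neg g b))

    zer : ∀ b → L (λ _ → 0ℤ) b ≡ 0ℤ
    zer b = idempotent⇒0 _ (add (λ _ → 0ℤ) (λ _ → 0ℤ) b)

    vanish : ∀ {f} → (∀ a → f a ≡ 0ℤ) → ∀ b → L f b ≡ 0ℤ
    vanish f≡0 b = trans (ext f≡0 b) (zer b)

    summ : ∀ {n} (f : Fin n → A → ℤ) b → L (λ a → sum (λ i → f i a)) b ≡ sum (λ i → L (f i) b)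
    summ {zero}  f b = zer b
    summ {suc n} f b = trans (add (f zero) _ b) (cong (L (f zero) b +_) (summ (f ∘ suc) b))

  sum-ω : ∀ {q} (f : Fin (suc q) → ℤ) → sum (f ∘ ω) ≡ sum f
  sum-ω {q} f = trans (ℤ.+-comm (f (fromℕ q)) _) (sym (sum-init-last f))

  -- Cells of the join of N copies of the cyclic group

  module Join (q : ℕ) where

    G : Set
    G = Fin (suc q)

    -- Each coordinate carries at most one vertex of its copy of `G`. The cell without vertices is
    -- included, so that chains are augmented.
    Cell : ℕ → Set
    Cell = Vec (Maybe G)

    NonEmpty : ∀ {N} → Cell N → Set
    NonEmpty X = ∃₂ λ i g → lookup X i ≡ just g

    infix 4 _⊑_ _⋖_

    _⊑_ : ∀ {N} → Cell N → Cell N → Set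
    X ⊑ Y = ∀ i g → lookup X i ≡ just g → lookup Y i ≡ just g

    -- The faces of codimension one, which are the cells at which `δ F σ` evaluates `F`.
    data _⋖_ : ∀ {N} → Cell N → Cell N → Set where
      here  : ∀ {N g} {σ : Cell N} → nothing ∷ σ ⋖ just g ∷ σ
      there : ∀ {N x} {ρ σ : Cell N} → ρ ⋖ σ → x ∷ ρ ⋖ x ∷ σ

    ⋖⇒⊑ : ∀ {N} {ρ σ : Cell N} → ρ ⋖ σ → ρ ⊑ σ
    ⋖⇒⊑ here      (suc i) g eq = eq
    ⋖⇒⊑ (there f) zero    g eq = eq
    ⋖⇒⊑ (there f) (suc i) g eq = ⋖⇒⊑ f i g eq

    size : ∀ {N} → Cell N → ℕ
    size []            = 0
    size (nothing ∷ σ) = size σ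
    size (just _ ∷ σ)  = suc (size σ)

    size-⋖ : ∀ {N} {ρ σ : Cell N} → ρ ⋖ σ → size σ ≡ suc (size ρ)
    size-⋖ here                     = refl
    size-⋖ (there {x = nothing} f) = size-⋖ f
    size-⋖ (there {x = just _} f)  = cong suc (size-⋖ f)

    size-suc⇒NonEmpty : ∀ {N} (σ : Cell N) {d} → size σ ≡ suc d → NonEmpty σ
    size-suc⇒NonEmpty (nothing ∷ σ) eq with size-suc⇒NonEmpty σ eq
    ... | i , g , e = suc i , g , e
    size-suc⇒NonEmpty (just g ∷ σ) eq = zero , g , refl

    rot : ∀ {N} → Cell N → Cell N
    rot = Vec.map (Maybe.map ω)

    size-rot : ∀ {N} (σ : Cell N) → size (rot σ) ≡ size σ
    size-rot []            = refl
    size-rot (nothing ∷ σ) = size-rot σ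
    size-rot (just _ ∷ σ)  = cong suc (size-rot σ)

    ∅ : ∀ {N} → Cell N
    ∅ = Vec.replicate _ nothing

    -- A function on cells is at the same time a chain (on which ∂ acts) and a
    -- linear form on chains (on which the transposed operators δ, κ, π act).
    ∂ δ κ π : ∀ {N} → (Cell N → ℤ) → Cell N → ℤ

    ∂ c []            = 0ℤ
    ∂ c (nothing ∷ τ) = sum (λ g → c (just g ∷ τ)) + ∂ (λ τ → c (nothing ∷ τ)) τ
    ∂ c (just g ∷ τ)  = - ∂ (λ τ → c (just g ∷ τ)) τ

    δ F []            = 0ℤ
    δ F (nothing ∷ σ) = δ (λ σ → F (nothing ∷ σ)) σ
    δ F (just g ∷ σ)  = F (nothing ∷ σ) - δ (λ σ → F (just g ∷ σ)) σ

    -- κ is the transpose of a contraction of the join onto its top-dimensional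
    -- cycles, and π that of the resulting projection.
    κ F []            = 0ℤ
    κ F (nothing ∷ σ) = F (just zero ∷ σ)
    κ F (just g ∷ σ)  = κ (λ σ → F (just zero ∷ σ)) σ - κ (λ σ → F (just g ∷ σ)) σ

    π F []            = F []
    π F (nothing ∷ σ) = 0ℤ
    π F (just g ∷ σ)  = π (λ σ → F (just g ∷ σ)) σ - π (λ σ → F (just zero ∷ σ)) σ

    private
      neg-sub : ∀ a b → - a - (- b) ≡ - (a - b)
      neg-sub = solve-∀
      add-sub : ∀ a b c d → (a + b) - (c + d) ≡ (a - c) + (b - d)
      add-sub = solve-∀

    ∂-linear : ∀ {N} → IsLinear (∂ {N})
    ∂-linear = record { ext = ext ; add = add ; neg = neg }
      where
      ext : ∀ {N} {c d : Cell N → ℤ} → (∀ τ → c τ ≡ d τ) → ∀ τ → ∂ c τ ≡ ∂ d τ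
      ext h []            = refl
      ext h (nothing ∷ τ) = cong₂ _+_ (sum-cong-≗ λ g → h (just g ∷ τ)) (ext (λ τ → h (nothing ∷ τ)) τ)
      ext h (just g ∷ τ)  = cong -_ (ext (λ τ → h (just g ∷ τ)) τ)
      add : ∀ {N} (c d : Cell N → ℤ) τ → ∂ (λ τ → c τ + d τ) τ ≡ ∂ c τ + ∂ d τ
      add c d []            = refl
      add c d (nothing ∷ τ) =
        trans (cong₂ _+_ (∑-distrib-+ (λ g → c (just g ∷ τ)) (λ g → d (just g ∷ τ))) (add _ _ τ))
              (interchange (sum (λ g → c (just g ∷ τ))) _ _ _)
      add c d (just g ∷ τ)  = trans (cong -_ (add _ _ τ)) (ℤ.neg-distrib-+ (∂ (λ τ → c (just g ∷ τ)) τ) _)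
      neg : ∀ {N} (c : Cell N → ℤ) τ → ∂ (λ τ → - c τ) τ ≡ - ∂ c τ
      neg c []            = refl
      neg c (nothing ∷ τ) =
        trans (cong₂ _+_ (sum-neg (λ g → c (just g ∷ τ))) (neg _ τ)) (sym (ℤ.neg-distrib-+ (sum (λ g → c (just g ∷ τ))) _))
      neg c (just g ∷ τ)  = cong -_ (neg _ τ)

    δ-local : ∀ {N} {F F′ : Cell N → ℤ} σ → (∀ ρ → ρ ⋖ σ → F ρ ≡ F′ ρ) → δ F σ ≡ δ F′ σ
    δ-local []            h = refl
    δ-local (nothing ∷ σ) h = δ-local σ λ ρ f → h (nothing ∷ ρ) (there f)
    δ-local (just g ∷ σ)  h = cong₂ _-_ (h (nothing ∷ σ) here) (δ-local σ λ ρ f → h (just g ∷ ρ) (there f))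

    δ-linear : ∀ {N} → IsLinear (δ {N})
    δ-linear = record { ext = λ h σ → δ-local σ λ ρ _ → h ρ ; add = add ; neg = neg }
      where
      add : ∀ {N} (c d : Cell N → ℤ) σ → δ (λ σ → c σ + d σ) σ ≡ δ c σ + δ d σ
      add c d []            = refl
      add c d (nothing ∷ σ) = add _ _ σ
      add c d (just g ∷ σ)  = trans (cong (_-_ (c (nothing ∷ σ) + d (nothing ∷ σ))) (add (λ σ → c (just g ∷ σ)) (λ σ → d (just g ∷ σ)) σ))
                                    (add-sub (c (nothing ∷ σ)) (d (nothing ∷ σ)) _ _)
      neg : ∀ {N} (c : Cell N → ℤ) σ → δ (λ σ → - c σ) σ ≡ - δ c σ
      neg c []            = refl
      neg c (nothing ∷ σ) = neg _ σ
      neg c (just g ∷ σ)  = trans (cong (_-_ (- c (nothing ∷ σ))) (neg (λ σ → c (just g ∷ σ)) σ)) (neg-sub (c (nothing ∷ σ)) _)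

    κ-linear : ∀ {N} → IsLinear (κ {N})
    κ-linear = record { ext = ext ; add = add ; neg = neg }
      where
      ext : ∀ {N} {c d : Cell N → ℤ} → (∀ τ → c τ ≡ d τ) → ∀ τ → κ c τ ≡ κ d τ
      ext h []            = refl
      ext h (nothing ∷ τ) = h (just zero ∷ τ)
      ext h (just g ∷ τ)  = cong₂ _-_ (ext (λ τ → h (just zero ∷ τ)) τ) (ext (λ τ → h (just g ∷ τ)) τ)
      add : ∀ {N} (c d : Cell N → ℤ) σ → κ (λ σ → c σ + d σ) σ ≡ κ c σ + κ d σ
      add c d []            = refl
      add c d (nothing ∷ σ) = refl
      add c d (just g ∷ σ)  = trans (cong₂ _-_ (add _ _ σ) (add _ _ σ)) (add-sub (κ (λ σ → c (just zero ∷ σ)) σ) _ _ _)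
      neg : ∀ {N} (c : Cell N → ℤ) σ → κ (λ σ → - c σ) σ ≡ - κ c σ
      neg c []            = refl
      neg c (nothing ∷ σ) = refl
      neg c (just g ∷ σ)  = trans (cong₂ _-_ (neg _ σ) (neg _ σ)) (neg-sub (κ (λ σ → c (just zero ∷ σ)) σ) _)

    module _ {A B : Set} {L : (A → ℤ) → B → ℤ} (linear : IsLinear L) where
      open IsLinear linear

      -- At a given cell `δ` is a fixed signed sum of values, so a linear operator in the other
      -- argument passes through it.
      δ-commute : ∀ {N} (M : A → Cell N → ℤ) σ b → δ (λ σ → L (λ a → M a σ) b) σ ≡ L (λ a → δ (M a) σ) b
      δ-commute M []            b = sym (zer b)
      δ-commute M (nothing ∷ σ) b = δ-commute (λ a σ → M a (nothing ∷ σ)) σ b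
      δ-commute M (just g ∷ σ)  b = 
        trans (cong (_-_ (L (λ a → M a (nothing ∷ σ)) b)) (δ-commute (λ a σ → M a (just g ∷ σ)) σ b))
              (sym (sub (λ a → M a (nothing ∷ σ)) (λ a → δ (λ σ → M a (just g ∷ σ)) σ) b))

      κ-commute : ∀ {N} (M : A → Cell N → ℤ) σ b → κ (λ σ → L (λ a → M a σ) b) σ ≡ L (λ a → κ (M a) σ) b
      κ-commute M []            b = sym (zer b)
      κ-commute M (nothing ∷ σ) b = refl
      κ-commute M (just g ∷ σ)  b =
        trans (cong₂ _-_ (κ-commute (λ a σ → M a (just zero ∷ σ)) σ b) (κ-commute (λ a σ → M a (just g ∷ σ)) σ b)) (sym (sub _ _ b))

    δδ≡0 : ∀ {N} (F : Cell N → ℤ) σ → δ (δ F) σ ≡ 0ℤ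
    δδ≡0 F []            = refl
    δδ≡0 F (nothing ∷ σ) = δδ≡0 _ σ
    δδ≡0 F (just g ∷ σ)  = begin
      δ Fₙ σ - δ (λ σ → Fₙ σ - δ F₁ σ) σ   ≡⟨ cong (_-_ (δ Fₙ σ)) (IsLinear.sub δ-linear Fₙ (δ F₁) σ) ⟩
      δ Fₙ σ - (δ Fₙ σ - δ (δ F₁) σ)       ≡⟨ cong (λ x → δ Fₙ σ - (δ Fₙ σ - x)) (δδ≡0 F₁ σ) ⟩
      δ Fₙ σ - (δ Fₙ σ - 0ℤ)               ≡⟨ cancel (δ Fₙ σ) ⟩
      0ℤ                                   ∎
      where
      open ≡-Reasoning
      Fₙ F₁ : Cell _ → ℤ
      Fₙ σ = F (nothing ∷ σ)
      F₁ σ = F (just g ∷ σ)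
      cancel : ∀ a → a - (a - 0ℤ) ≡ 0ℤ
      cancel = solve-∀

    -- Acyclicity below the top dimension: `π F` vanishes on every cell with an empty coordinate.
    -- For `just g` the terms `κ Fₙ σ` cancel, and the induction hypotheses for the slices `F₀` and
    -- `F₁` remain.
    contraction : ∀ {N} (F : Cell N → ℤ) σ → κ (δ F) σ + δ (κ F) σ ≡ F σ - π F σ
    contraction F []            = sym (ℤ.+-inverseʳ (F []))
    contraction F (nothing ∷ σ) = lemma (F (nothing ∷ σ)) _
      where
      lemma : ∀ a b → (a - b) + b ≡ a - 0ℤ
      lemma = solve-∀
    contraction F (just g ∷ σ)  = begin
      (κ (λ σ → Fₙ σ - δ F₀ σ) σ - κ (λ σ → Fₙ σ - δ F₁ σ) σ) + (F₀ σ - δ (λ σ → κ F₀ σ - κ F₁ σ) σ)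
        ≡⟨ cong₂ _+_ (cong₂ _-_ (IsLinear.sub κ-linear Fₙ (δ F₀) σ) (IsLinear.sub κ-linear Fₙ (δ F₁) σ))
                     (cong (_-_ (F₀ σ)) (IsLinear.sub δ-linear (κ F₀) (κ F₁) σ)) ⟩
      ((κ Fₙ σ - κ (δ F₀) σ) - (κ Fₙ σ - κ (δ F₁) σ)) + (F₀ σ - (δ (κ F₀) σ - δ (κ F₁) σ))
        ≡⟨ regroup (κ Fₙ σ) (κ (δ F₀) σ) (κ (δ F₁) σ) (F₀ σ) (δ (κ F₀) σ) (δ (κ F₁) σ) ⟩
      F₀ σ - (κ (δ F₀) σ + δ (κ F₀) σ) + (κ (δ F₁) σ + δ (κ F₁) σ)
        ≡⟨ cong₂ (λ x y → F₀ σ - x + y) (contraction F₀ σ) (contraction F₁ σ) ⟩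
      F₀ σ - (F₀ σ - π F₀ σ) + (F₁ σ - π F₁ σ)
        ≡⟨ collect (F₀ σ) (π F₀ σ) (F₁ σ) (π F₁ σ) ⟩
      F₁ σ - (π F₁ σ - π F₀ σ) ∎
      where
      open ≡-Reasoning
      Fₙ F₀ F₁ : Cell _ → ℤ
      Fₙ σ = F (nothing ∷ σ)
      F₀ σ = F (just zero ∷ σ)
      F₁ σ = F (just g ∷ σ)
      regroup : ∀ a b c d e f → ((a - b) - (a - c)) + (d - (e - f)) ≡ d - (b + e) + (c + f)
      regroup = solve-∀
      collect : ∀ a b c d → a - (a - b) + (c - d) ≡ c - (d - b)
      collect = solve-∀

    π-vanish : ∀ {N} (F : Cell N → ℤ) → (∀ σ → F σ ≡ 0ℤ) → ∀ σ → π F σ ≡ 0ℤ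
    π-vanish F h []            = h []
    π-vanish F h (nothing ∷ σ) = refl
    π-vanish F h (just g ∷ σ)  = cong₂ _-_ (π-vanish _ (λ σ → h (just g ∷ σ)) σ) (π-vanish _ (λ σ → h (just zero ∷ σ)) σ)

    -- The sign of a cell is the parity of its size, so on the diagonal of a matrix this is the
    -- supertrace.
    str : ∀ {N} → (Cell N → ℤ) → ℤ
    str {zero}  u = u []
    str {suc N} u = str (λ σ → u (nothing ∷ σ)) - sum (λ g → str (λ σ → u (just g ∷ σ)))

    str-cong : ∀ {N} {u v : Cell N → ℤ} → (∀ σ → u σ ≡ v σ) → str u ≡ str v
    str-cong {zero}  h = h []
    str-cong {suc N} h = cong₂ _-_ (str-cong λ σ → h (nothing ∷ σ)) (sum-cong-≗ λ g → str-cong λ σ → h (just g ∷ σ))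

    str-add : ∀ {N} (u v : Cell N → ℤ) → str (λ σ → u σ + v σ) ≡ str u + str v
    str-add {zero}  u v = refl
    str-add {suc N} u v =
      trans (cong₂ _-_ (str-add (λ σ → u (nothing ∷ σ)) (λ σ → v (nothing ∷ σ)))
                       (trans (sum-cong-≗ λ g → str-add (λ σ → u (just g ∷ σ)) (λ σ → v (just g ∷ σ)))
                              (∑-distrib-+ (λ g → str (λ σ → u (just g ∷ σ))) (λ g → str (λ σ → v (just g ∷ σ))))))
            (add-sub (str (λ σ → u (nothing ∷ σ))) _ _ _)

    str-sum : ∀ {N n} (u : Fin n → Cell N → ℤ) → str (λ σ → sum (λ i → u i σ)) ≡ sum (λ i → str (u i))
    str-sum {N} {zero}  u = str-zero {N}
      where
      str-zero : ∀ {N} → str {N} (λ _ → 0ℤ) ≡ 0ℤ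
      str-zero {N} = idempotent⇒0 _ (str-add {N} (λ _ → 0ℤ) (λ _ → 0ℤ))
    str-sum {N} {suc n} u = trans (str-add (u zero) _) (cong (str (u zero) +_) (str-sum (u ∘ suc)))

    -- Graded commutators have supertrace zero.
    str-commutator : ∀ {N} (M : Cell N → Cell N → ℤ) →
                     str (λ σ → ∂ (λ τ → M τ σ) σ + δ (M σ) σ) ≡ 0ℤ
    str-commutator {zero}  M = refl
    str-commutator {suc N} M = begin
      str (λ σ → (sum (λ g → m g σ) + ∂ (λ τ → Mₙ τ σ) σ) + δ (Mₙ σ) σ)
        - sum (λ g → str (λ σ → - ∂ (λ τ → M₁ g τ σ) σ + (m g σ - δ (M₁ g σ) σ)))
        ≡⟨ cong₂ _-_ left (sum-cong-≗ right) ⟩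
      sum (λ g → str (m g)) - sum (λ g → str (m g))
        ≡⟨ ℤ.+-inverseʳ (sum (λ g → str (m g))) ⟩
      0ℤ ∎
      where
      open ≡-Reasoning
      Mₙ : Cell N → Cell N → ℤ
      Mₙ τ σ = M (nothing ∷ τ) (nothing ∷ σ)
      M₁ : G → Cell N → Cell N → ℤ
      M₁ g τ σ = M (just g ∷ τ) (just g ∷ σ)
      -- The entries `m g` arise once from `∂` on cells with empty first coordinate and once from
      -- `δ` on the others. What remains in either case is, up to sign, a commutator for `N`.
      m : G → Cell N → ℤ
      m g σ = M (just g ∷ σ) (nothing ∷ σ)
      left : str (λ σ → (sum (λ g → m g σ) + ∂ (λ τ → Mₙ τ σ) σ) + δ (Mₙ σ) σ) ≡ sum (λ g → str (m g))
      left = begin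
        _ ≡⟨ str-cong (λ σ → ℤ.+-assoc (sum (λ g → m g σ)) _ _) ⟩
        _ ≡⟨ str-add (λ σ → sum (λ g → m g σ)) _ ⟩
        _ ≡⟨ cong₂ _+_ (str-sum m) (str-commutator Mₙ) ⟩
        _ ≡⟨ ℤ.+-identityʳ _ ⟩
        _ ∎
      flip-sign : ∀ a b c → - a + (b - c) + (a + c) ≡ b
      flip-sign = solve-∀
      right : ∀ g → str (λ σ → - ∂ (λ τ → M₁ g τ σ) σ + (m g σ - δ (M₁ g σ) σ)) ≡ str (m g)
      right g = begin
        str u               ≡⟨ ℤ.+-identityʳ _ ⟨
        str u + 0ℤ          ≡⟨ cong (str u +_) (str-commutator (M₁ g)) ⟨
        str u + str v       ≡⟨ str-add u v ⟨
        str (λ σ → u σ + v σ) ≡⟨ str-cong (λ σ → flip-sign (∂ (λ τ → M₁ g τ σ) σ) _ _) ⟩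
        str (m g)           ∎
        where
        u v : Cell N → ℤ
        u σ = - ∂ (λ τ → M₁ g τ σ) σ + (m g σ - δ (M₁ g σ) σ)
        v σ = ∂ (λ τ → M₁ g τ σ) σ + δ (M₁ g σ) σ

    str-rot : ∀ {N} (u : Cell N → ℤ) → str (u ∘ rot) ≡ str u
    str-rot {zero}  u = refl
    str-rot {suc N} u = cong₂ _-_ (str-rot (λ σ → u (nothing ∷ σ)))
      (trans (sum-cong-≗ λ g → str-rot (λ σ → u (just (ω g) ∷ σ))) (sum-ω (λ g → str (λ σ → u (just g ∷ σ)))))

    -- The rotation acts freely on the nonempty cells.
    str-invariant : ∀ {N} (u : Cell N → ℤ) → (∀ σ → u (rot σ) ≡ u σ) → ∃ λ z → str u ≡ u ∅ + ℤ.+ suc q * z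
    str-invariant {zero}  u h = 0ℤ , sym (trans (cong (u [] +_) (ℤ.*-zeroʳ (ℤ.+ suc q))) (ℤ.+-identityʳ _))
    str-invariant {suc N} u h with str-invariant (λ σ → u (nothing ∷ σ)) (λ σ → h (nothing ∷ σ))
    -- All `suc q` slices with a sign in the first coordinate have the same supertrace, so together
    -- they contribute a multiple of `suc q`.
    ... | z , eq = z - str (λ σ → u (just zero ∷ σ)) ,
        trans (cong₂ _-_ eq (sum-const _ _ (ω-constant (λ g → str (λ σ → u (just g ∷ σ))) step)))
              (collect (u ∅) (ℤ.+ suc q) z _)
      where
      collect : ∀ a b c d → a + b * c - b * d ≡ a + b * (c - d)
      collect = solve-∀
      step : ∀ g → str (λ σ → u (just (ω g) ∷ σ)) ≡ str (λ σ → u (just g ∷ σ))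
      step g = trans (sym (str-rot (λ σ → u (just (ω g) ∷ σ)))) (str-cong λ σ → h (just g ∷ σ))

    -- Left multiplication by the vertex with sign g in coordinate l.
    wedge : ∀ {N} → Fin N → G → (Cell N → ℤ) → Cell N → ℤ
    wedge zero    g c (nothing ∷ τ) = 0ℤ
    wedge zero    g c (just h ∷ τ) with h Fin.≟ g
    ... | yes _ = c (nothing ∷ τ)
    ... | no  _ = 0ℤ
    wedge (suc l) g c (nothing ∷ τ) = wedge l g (λ τ → c (nothing ∷ τ)) τ
    wedge (suc l) g c (just h ∷ τ)  = - wedge l g (λ τ → c (just h ∷ τ)) τ

    wedge-linear : ∀ {N} (l : Fin N) g → IsLinear (wedge l g)
    wedge-linear l g = record { ext = ext l ; add = add l ; neg = neg l }
      where
      ext : ∀ {N} (l : Fin N) {c d : Cell N → ℤ} → (∀ τ → c τ ≡ d τ) → ∀ τ → wedge l g c τ ≡ wedge l g d τ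
      ext zero    e (nothing ∷ τ) = refl
      ext zero    e (just h ∷ τ) with h Fin.≟ g
      ... | yes _ = e (nothing ∷ τ)
      ... | no  _ = refl
      ext (suc l) e (nothing ∷ τ) = ext l (λ τ → e (nothing ∷ τ)) τ
      ext (suc l) e (just h ∷ τ)  = cong -_ (ext l (λ τ → e (just h ∷ τ)) τ)
      add : ∀ {N} (l : Fin N) (c d : Cell N → ℤ) τ → wedge l g (λ τ → c τ + d τ) τ ≡ wedge l g c τ + wedge l g d τ
      add zero    c d (nothing ∷ τ) = refl
      add zero    c d (just h ∷ τ) with h Fin.≟ g
      ... | yes _ = refl
      ... | no  _ = refl
      add (suc l) c d (nothing ∷ τ) = add l _ _ τ
      add (suc l) c d (just h ∷ τ)  = trans (cong -_ (add l _ _ τ)) (ℤ.neg-distrib-+ (wedge l g (λ τ → c (just h ∷ τ)) τ) _)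
      neg : ∀ {N} (l : Fin N) (c : Cell N → ℤ) τ → wedge l g (λ τ → - c τ) τ ≡ - wedge l g c τ
      neg zero    c (nothing ∷ τ) = refl
      neg zero    c (just h ∷ τ) with h Fin.≟ g
      ... | yes _ = refl
      ... | no  _ = refl
      neg (suc l) c (nothing ∷ τ) = neg l _ τ
      neg (suc l) c (just h ∷ τ)  = cong -_ (neg l _ τ)

    -- The Leibniz rule for wedging with a vertex v. Cells that already contain v are annihilated,
    -- as v ∧ v = 0; the support hypothesis rules out cells with another vertex in the same
    -- coordinate, which have no join with v.
    ∂-wedge : ∀ {N} (l : Fin N) g (c : Cell N → ℤ) → (∀ τ h → lookup τ l ≡ just h → h ≢ g → c τ ≡ 0ℤ) →
              ∀ τ → ∂ (wedge l g c) τ ≡ c τ - wedge l g (∂ c) τ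
    ∂-wedge zero g c supp (nothing ∷ τ) = begin
      sum (λ h → wedge zero g c (just h ∷ τ)) + ∂ (λ _ → 0ℤ) τ
        ≡⟨ cong₂ _+_ (sum-single _ g off) (IsLinear.zer ∂-linear τ) ⟩
      wedge zero g c (just g ∷ τ) + 0ℤ
        ≡⟨ cong (_+ 0ℤ) on ⟩
      c (nothing ∷ τ) - 0ℤ ∎
      where
      open ≡-Reasoning
      off : ∀ h → h ≢ g → wedge zero g c (just h ∷ τ) ≡ 0ℤ
      off h h≢g with h Fin.≟ g
      ... | yes h≡g = ⊥-elim (h≢g h≡g)
      ... | no  _   = refl
      on : wedge zero g c (just g ∷ τ) ≡ c (nothing ∷ τ)
      on with g Fin.≟ g
      ... | yes _   = refl
      ... | no  g≢g = ⊥-elim (g≢g refl)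
    ∂-wedge zero g c supp (just h ∷ τ) with h Fin.≟ g
    ... | yes refl = sym (begin
      c (just h ∷ τ) - (sum (λ h → c (just h ∷ τ)) + ∂ (λ τ → c (nothing ∷ τ)) τ)
        ≡⟨ cong (λ x → c (just h ∷ τ) - (x + ∂ (λ τ → c (nothing ∷ τ)) τ)) (sum-single _ h λ i i≢h → supp (just i ∷ τ) i refl i≢h) ⟩
      c (just h ∷ τ) - (c (just h ∷ τ) + ∂ (λ τ → c (nothing ∷ τ)) τ)
        ≡⟨ cancel (c (just h ∷ τ)) _ ⟩
      - ∂ (λ τ → c (nothing ∷ τ)) τ ∎)
      where
      open ≡-Reasoning
      cancel : ∀ a b → a - (a + b) ≡ - b
      cancel = solve-∀
    ... | no h≢g = trans (cong -_ (IsLinear.zer ∂-linear τ)) (cong (_- 0ℤ) (sym (supp (just h ∷ τ) h refl h≢g)))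
    ∂-wedge (suc l) g c supp (nothing ∷ τ) = begin
      sum (λ h → - wedge l g (c₁ h) τ) + ∂ (wedge l g cₙ) τ
        ≡⟨ cong₂ _+_ (sum-neg (λ h → wedge l g (c₁ h) τ)) (∂-wedge l g cₙ (λ τ → supp (nothing ∷ τ)) τ) ⟩
      - sum (λ h → wedge l g (c₁ h) τ) + (cₙ τ - wedge l g (∂ cₙ) τ)
        ≡⟨ regroup (sum (λ h → wedge l g (c₁ h) τ)) (cₙ τ) _ ⟩
      cₙ τ - (sum (λ h → wedge l g (c₁ h) τ) + wedge l g (∂ cₙ) τ)
        ≡⟨ cong (λ x → cₙ τ - (x + wedge l g (∂ cₙ) τ)) (IsLinear.summ (wedge-linear l g) c₁ τ) ⟨
      cₙ τ - (wedge l g (λ τ → sum (λ h → c₁ h τ)) τ + wedge l g (∂ cₙ) τ)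
        ≡⟨ cong (_-_ (cₙ τ)) (IsLinear.add (wedge-linear l g) (λ τ → sum (λ h → c₁ h τ)) (∂ cₙ) τ) ⟨
      cₙ τ - wedge l g (λ τ → sum (λ h → c₁ h τ) + ∂ cₙ τ) τ ∎
      where
      open ≡-Reasoning
      cₙ : Cell _ → ℤ
      cₙ τ = c (nothing ∷ τ)
      c₁ : G → Cell _ → ℤ
      c₁ h τ = c (just h ∷ τ)
      regroup : ∀ a b c → - a + (b - c) ≡ b - (a + c)
      regroup = solve-∀
    ∂-wedge (suc l) g c supp (just h ∷ τ) = begin
      - ∂ (λ τ → - wedge l g c₁ τ) τ     ≡⟨ cong -_ (IsLinear.neg ∂-linear (wedge l g c₁) τ) ⟩
      - (- ∂ (wedge l g c₁) τ)           ≡⟨ cong (λ x → - (- x)) (∂-wedge l g c₁ (λ τ → supp (just h ∷ τ)) τ) ⟩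
      - (- (c₁ τ - wedge l g (∂ c₁) τ))  ≡⟨ signs (c₁ τ) _ ⟩
      c₁ τ - (- (- wedge l g (∂ c₁) τ))  ≡⟨ cong (λ x → c₁ τ - (- x)) (IsLinear.neg (wedge-linear l g) (∂ c₁) τ) ⟨
      c₁ τ - (- wedge l g (λ τ → - ∂ c₁ τ) τ) ∎
      where
      open ≡-Reasoning
      c₁ : Cell _ → ℤ
      c₁ τ = c (just h ∷ τ)
      signs : ∀ a b → - (- (a - b)) ≡ a - (- (- b))
      signs = solve-∀

    -- Wedging adds no vertex other than (`l` , `g`).
    wedge-support : ∀ {N} (l : Fin N) g (k : Fin N) h (c : Cell N → ℤ) → ¬ (l ≡ k × g ≡ h) →
                    (∀ τ → lookup τ k ≡ just h → c τ ≡ 0ℤ) →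
                    ∀ τ → lookup τ k ≡ just h → wedge l g c τ ≡ 0ℤ
    wedge-support zero    g zero    h c ≢ supp (just h ∷ τ) refl with h Fin.≟ g
    ... | yes h≡g = ⊥-elim (≢ (refl , sym h≡g))
    ... | no  _   = refl
    wedge-support zero    g (suc k) h c ≢ supp (nothing ∷ τ) eq = refl
    wedge-support zero    g (suc k) h c ≢ supp (just i ∷ τ)  eq with i Fin.≟ g
    ... | yes _ = supp (nothing ∷ τ) eq
    ... | no  _ = refl
    wedge-support (suc l) g zero    h c ≢ supp (just h ∷ τ) refl =
      cong -_ (IsLinear.vanish (wedge-linear l g) (λ τ → supp (just h ∷ τ) refl) τ)
    wedge-support (suc l) g (suc k) h c ≢ supp (nothing ∷ τ) eq =
      wedge-support l g k h _ (λ (e , e′) → ≢ (cong suc e , e′)) (λ τ → supp (nothing ∷ τ)) τ eq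
    wedge-support (suc l) g (suc k) h c ≢ supp (just i ∷ τ) eq =
      cong -_ (wedge-support l g k h _ (λ (e , e′) → ≢ (cong suc e , e′)) (λ τ → supp (just i ∷ τ)) τ eq)

    wedge-rot : ∀ {N} (l : Fin N) g (c : Cell N → ℤ) τ → wedge l (ω g) c (rot τ) ≡ wedge l g (c ∘ rot) τ
    wedge-rot zero    g c (nothing ∷ τ) = refl
    wedge-rot zero    g c (just h ∷ τ) with ω h Fin.≟ ω g | h Fin.≟ g
    ... | yes _ | yes _    = refl
    ... | yes e | no  h≢g  = ⊥-elim (h≢g (ω-injective e))
    ... | no  e | yes refl = ⊥-elim (e refl)
    ... | no  _ | no  _    = refl
    wedge-rot (suc l) g c (nothing ∷ τ) = wedge-rot l g _ τ
    wedge-rot (suc l) g c (just h ∷ τ)  = cong -_ (wedge-rot l g _ τ)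

    δ-rot : ∀ {N} (F : Cell N → ℤ) σ → δ F (rot σ) ≡ δ (F ∘ rot) σ
    δ-rot F []            = refl
    δ-rot F (nothing ∷ σ) = δ-rot _ σ
    δ-rot F (just g ∷ σ)  = cong (_-_ (F (nothing ∷ rot σ))) (δ-rot (λ σ → F (just (ω g) ∷ σ)) σ)

    -- The empty cell as a chain; this is the value of `φ` at the empty cell.
    𝟙 : ∀ {N} → Cell N → ℤ
    𝟙 []            = 1ℤ
    𝟙 (nothing ∷ τ) = 𝟙 τ
    𝟙 (just _ ∷ τ)  = 0ℤ

    𝟙-∅ : ∀ N → 𝟙 (∅ {N}) ≡ 1ℤ
    𝟙-∅ zero    = refl
    𝟙-∅ (suc N) = 𝟙-∅ N

    𝟙-support : ∀ {N} (τ : Cell N) i {g} → lookup τ i ≡ just g → 𝟙 τ ≡ 0ℤ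
    𝟙-support (just _ ∷ τ)  i       eq = refl
    𝟙-support (nothing ∷ τ) (suc i) eq = 𝟙-support τ i eq

    𝟙-rot : ∀ {N} (τ : Cell N) → 𝟙 (rot τ) ≡ 𝟙 τ
    𝟙-rot []            = refl
    𝟙-rot (nothing ∷ τ) = 𝟙-rot τ
    𝟙-rot (just _ ∷ τ)  = refl

    ∂-𝟙 : ∀ {N} (τ : Cell N) → ∂ 𝟙 τ ≡ 0ℤ
    ∂-𝟙 []            = refl
    ∂-𝟙 (nothing ∷ τ) = cong₂ _+_ (sum-zero {suc q} (λ _ → 0ℤ) λ _ → refl) (∂-𝟙 τ)
    ∂-𝟙 (just _ ∷ τ)  = cong -_ (IsLinear.zer ∂-linear τ)

    size-∅ : ∀ N → size (∅ {N}) ≡ 0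
    size-∅ zero    = refl
    size-∅ (suc N) = size-∅ N

    δ-vertexless : ∀ {N} (F : Cell N → ℤ) σ → size σ ≡ 0 → δ F σ ≡ 0ℤ
    δ-vertexless F []            eq = refl
    δ-vertexless F (nothing ∷ σ) eq = δ-vertexless _ σ eq

    -- The label (lev X , sgn X) is a vertex of the join, and lev never takes the
    -- value zero, so labels span a join with one factor less.
    module Tucker {N : ℕ}
      (lev : Cell (suc N) → Fin (suc N)) (sgn : Cell (suc N) → G)
      (lev≢0 : ∀ X → NonEmpty X → lev X ≢ zero)
      (lev-rot : ∀ X → NonEmpty X → lev (rot X) ≡ lev X)
      (sgn-rot : ∀ X → NonEmpty X → sgn (rot X) ≡ ω (sgn X))
      (coherent : ∀ X Y → NonEmpty X → X ⊑ Y → lev X ≡ lev Y → sgn X ≡ sgn Y)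
      where

      -- Φ d is the degree d part of the chain map induced by the labelling on the
      -- barycentric subdivision: φ σ = (label of σ) ∧ φ (∂ σ).
      Φ : ℕ → Cell (suc N) → Cell (suc N) → ℤ
      Φ zero    σ τ = 𝟙 τ
      Φ (suc d) σ τ = wedge (lev σ) (sgn σ) (λ τ → δ (λ ρ → Φ d ρ τ) σ) τ

      φ : Cell (suc N) → Cell (suc N) → ℤ
      φ σ = Φ (size σ) σ

      ⋖-size : ∀ {ρ σ : Cell (suc N)} {d} → ρ ⋖ σ → size σ ≡ suc d → size ρ ≡ d
      ⋖-size ρ⋖σ eq = ℕ.suc-injective (trans (sym (size-⋖ ρ⋖σ)) eq)

      -- All vertices in `Φ d σ` are labels of nonempty faces of `σ`: wedging adds the label of `σ`,
      -- and the facets supply the others by induction.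
      Φ-support : ∀ d σ → size σ ≡ d → ∀ l g → (∀ X → NonEmpty X → X ⊑ σ → ¬ (lev X ≡ l × sgn X ≡ g)) →
                  ∀ τ → lookup τ l ≡ just g → Φ d σ τ ≡ 0ℤ
      Φ-support zero    σ eq l g avoid τ τₗ≡g = 𝟙-support τ l τₗ≡g
      Φ-support (suc d) σ eq l g avoid τ τₗ≡g =
        wedge-support (lev σ) (sgn σ) l g _ (avoid σ (size-suc⇒NonEmpty σ eq) λ _ _ e → e)
          (λ τ e → trans (δ-local σ λ ρ ρ⋖σ → Φ-support d ρ (⋖-size ρ⋖σ eq) l g
                                        (λ X ne X⊑ρ → avoid X ne λ i h → ⋖⇒⊑ ρ⋖σ i h ∘ X⊑ρ i h) τ e)
                         (IsLinear.zer δ-linear σ))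
          τ τₗ≡g

      -- No label has level zero. As top-dimensional cells use every coordinate, none of them occurs
      -- in the image of `φ`.
      Φ-zeroth : ∀ d σ → size σ ≡ d → ∀ g τ → Φ d σ (just g ∷ τ) ≡ 0ℤ
      Φ-zeroth d σ eq g τ = Φ-support d σ eq zero g (λ X ne _ (e , _) → lev≢0 X ne e) (just g ∷ τ) refl

      -- By the Leibniz rule the boundary is `c` minus a wedge with `∂ c`. By induction `∂ c` is `φ`
      -- applied to the boundary of a boundary, hence zero.
      Φ-chain : ∀ d σ → size σ ≡ d → ∀ τ → ∂ (Φ d σ) τ ≡ δ (λ ρ → φ ρ τ) σ
      Φ-chain zero    σ eq τ = trans (∂-𝟙 τ) (sym (δ-vertexless _ σ eq))
      Φ-chain (suc d) σ eq τ = begin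
        ∂ (wedge (lev σ) (sgn σ) c) τ             ≡⟨ ∂-wedge (lev σ) (sgn σ) c compatible τ ⟩
        c τ - wedge (lev σ) (sgn σ) (∂ c) τ       ≡⟨ cong (_-_ (c τ)) (IsLinear.vanish (wedge-linear (lev σ) (sgn σ)) cycle τ) ⟩
        c τ - 0ℤ                                  ≡⟨ ℤ.+-identityʳ (c τ) ⟩
        c τ                                       ≡⟨ δ-local σ (λ ρ ρ⋖σ → cong (λ d → Φ d ρ τ) (⋖-size ρ⋖σ eq)) ⟨
        δ (λ ρ → φ ρ τ) σ                         ∎
        where
        open ≡-Reasoning
        c : Cell (suc N) → ℤ
        c τ = δ (λ ρ → Φ d ρ τ) σ
        -- A face of `σ` with the level of `σ` also has the sign of `σ`, so no conflicting vertex
        -- occurs in `c`.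
        compatible : ∀ τ h → lookup τ (lev σ) ≡ just h → h ≢ sgn σ → c τ ≡ 0ℤ
        compatible τ h τₗ≡h h≢g =
          trans (δ-local σ λ ρ ρ⋖σ → Φ-support d ρ (⋖-size ρ⋖σ eq) (lev σ) h
                   (λ X ne X⊑ρ (e , e′) → h≢g (trans (sym e′) (coherent X σ ne (λ i g → ⋖⇒⊑ ρ⋖σ i g ∘ X⊑ρ i g) e))) τ τₗ≡h)
                (IsLinear.zer δ-linear σ)
        cycle : ∀ τ → ∂ c τ ≡ 0ℤ
        cycle τ = begin
          ∂ c τ                            ≡⟨ δ-commute ∂-linear (λ τ ρ → Φ d ρ τ) σ τ ⟨
          δ (λ ρ → ∂ (Φ d ρ) τ) σ          ≡⟨ δ-local σ (λ ρ ρ⋖σ → Φ-chain d ρ (⋖-size ρ⋖σ eq) τ) ⟩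
          δ (δ (λ ρ → φ ρ τ)) σ            ≡⟨ δδ≡0 (λ ρ → φ ρ τ) σ ⟩
          0ℤ                               ∎

      Φ-rot : ∀ d σ → size σ ≡ d → ∀ τ → Φ d (rot σ) (rot τ) ≡ Φ d σ τ
      Φ-rot zero    σ eq τ = 𝟙-rot τ
      Φ-rot (suc d) σ eq τ = begin
        wedge (lev (rot σ)) (sgn (rot σ)) (λ τ → δ (λ ρ → Φ d ρ τ) (rot σ)) (rot τ)
          ≡⟨ cong₂ (λ l g → wedge l g (λ τ → δ (λ ρ → Φ d ρ τ) (rot σ)) (rot τ)) (lev-rot σ ne) (sgn-rot σ ne) ⟩
        wedge (lev σ) (ω (sgn σ)) (λ τ → δ (λ ρ → Φ d ρ τ) (rot σ)) (rot τ)
          ≡⟨ wedge-rot (lev σ) (sgn σ) _ τ ⟩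
        wedge (lev σ) (sgn σ) (λ τ → δ (λ ρ → Φ d ρ (rot τ)) (rot σ)) τ
          ≡⟨ IsLinear.ext (wedge-linear (lev σ) (sgn σ))
               (λ τ → trans (δ-rot _ σ) (δ-local σ λ ρ ρ⋖σ → Φ-rot d ρ (⋖-size ρ⋖σ eq) τ)) τ ⟩
        wedge (lev σ) (sgn σ) (λ τ → δ (λ ρ → Φ d ρ τ) σ) τ ∎
        where
        open ≡-Reasoning
        ne : NonEmpty σ
        ne = size-suc⇒NonEmpty σ eq

      φ-invariant : ∀ σ → φ (rot σ) (rot σ) ≡ φ σ σ
      φ-invariant σ = trans (cong (λ d → Φ d (rot σ) (rot σ)) (size-rot σ)) (Φ-rot (size σ) σ refl σ)

      -- `M` is the matrix of `φ` after the contraction, so on the diagonal `φ` is a graded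
      -- commutator plus a projection term. That term vanishes: `π` is zero at cells with empty
      -- first coordinate, and `φ` never produces the others.
      lefschetz : str (λ σ → φ σ σ) ≡ 0ℤ
      lefschetz = trans (str-cong homotopy) (str-commutator M)
        where
        open ≡-Reasoning
        M : Cell (suc N) → Cell (suc N) → ℤ
        M τ σ = κ (λ ρ → φ ρ τ) σ
        project : ∀ σ → π (λ ρ → φ ρ σ) σ ≡ 0ℤ
        project (nothing ∷ σ) = refl
        project (just g ∷ σ)  = π-vanish (λ ρ → φ ρ (just g ∷ σ)) (λ ρ → Φ-zeroth (size ρ) ρ refl g σ) (just g ∷ σ)
        homotopy : ∀ σ → φ σ σ ≡ ∂ (λ τ → M τ σ) σ + δ (M σ) σ
        homotopy σ = begin
          φ σ σ                                         ≡⟨ ℤ.+-identityʳ _ ⟨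
          φ σ σ - 0ℤ                                    ≡⟨ cong (_-_ (φ σ σ)) (project σ) ⟨
          φ σ σ - π (λ ρ → φ ρ σ) σ                     ≡⟨ contraction (λ ρ → φ ρ σ) σ ⟨
          κ (δ (λ ρ → φ ρ σ)) σ + δ (M σ) σ             ≡⟨ cong (_+ δ (M σ) σ) (IsLinear.ext κ-linear (λ ρ → Φ-chain (size ρ) ρ refl σ) σ) ⟨
          κ (λ ρ → ∂ (φ ρ) σ) σ + δ (M σ) σ             ≡⟨ cong (_+ δ (M σ) σ) (κ-commute ∂-linear (λ τ ρ → φ ρ τ) σ σ) ⟩
          ∂ (λ τ → M τ σ) σ + δ (M σ) σ                 ∎

      -- The Lefschetz number is 0, and by invariance it is 1 plus a multiple of `suc q`; hence
      -- `suc q` divides 1.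
      tucker : q ≡ 0
      tucker with str-invariant (λ σ → φ σ σ) φ-invariant
      ... | z , eq = ℕ.suc-injective (ℕ.m*n≡1⇒m≡1 (suc q) ℤ.∣ - z ∣ (trans (sym (ℤ.abs-* (ℤ.+ suc q) (- z))) (cong ℤ.∣_∣ unit)))
        where
        open ≡-Reasoning
        solve-for : ∀ a b → a * (- b) ≡ 1ℤ - (1ℤ + a * b)
        solve-for = solve-∀
        φ-∅ : φ ∅ ∅ ≡ 1ℤ
        φ-∅ = trans (cong (λ d → Φ d ∅ ∅) (size-∅ (suc N))) (𝟙-∅ (suc N))
        unit : ℤ.+ suc q * (- z) ≡ 1ℤ
        unit = begin
          ℤ.+ suc q * (- z)                   ≡⟨ solve-for (ℤ.+ suc q) z ⟩
          1ℤ - (1ℤ + ℤ.+ suc q * z)           ≡⟨ cong (λ x → 1ℤ - (x + ℤ.+ suc q * z)) φ-∅ ⟨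
          1ℤ - (φ ∅ ∅ + ℤ.+ suc q * z)        ≡⟨ cong (_-_ 1ℤ) (trans (sym eq) lefschetz) ⟩
          1ℤ - 0ℤ                             ≡⟨⟩
          1ℤ                                  ∎

    no-labelling : ∀ {N} (lev : Cell N → ℕ) (sgn : Cell N → G) →
      (∀ X → lev X ℕ.< N) →
      (∀ X → NonEmpty X → 0 ℕ.< lev X) →
      (∀ X → NonEmpty X → lev (rot X) ≡ lev X) →
      (∀ X → NonEmpty X → sgn (rot X) ≡ ω (sgn X)) →
      (∀ X Y → NonEmpty X → X ⊑ Y → lev X ≡ lev Y → sgn X ≡ sgn Y) →
      q ≡ 0
    no-labelling {zero}  lev sgn lev<N _ _ _ _ = ⊥-elim (ℕ.n≮0 (lev<N []))
    no-labelling {suc N} lev sgn lev<N lev>0 lev-rot sgn-rot coherent =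
      Tucker.tucker (λ X → fromℕ< (lev<N X)) sgn
        (λ X ne eq → ℕ.<⇒≢ (lev>0 X ne) (trans (sym (cong toℕ eq)) (Fin.toℕ-fromℕ< (lev<N X))))
        (λ X ne → Fin.fromℕ<-cong _ _ (lev-rot X ne) (lev<N (rot X)) (lev<N X))
        sgn-rot
        (λ X Y ne X⊑Y eq → coherent X Y ne X⊑Y (Fin.fromℕ<-injective _ _ (lev<N X) (lev<N Y) eq))

open EquivariantLabelling using (module Join)

open import Data.Nat using (_+_; _*_; _∸_; _^_; _⊓_; _/_; _%_; _≤_; _<_; z≤n; s≤s; s≤s⁻¹; NonZero; >-nonZero; nonTrivial⇒n>1; n>1⇒nonTrivial)
open import Data.Nat.Properties
open import Data.Nat.DivMod using (_mod_; m%n<n; m≡m%n+[m/n]*n; m<n⇒m%n≡m; [m+kn]%n≡m%n; %-pred-≡0; n%n≡0; m*[n/m]≡n; m<n*o⇒m/o<n)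
open import Data.Nat.Divisibility
open import Data.Nat.Primality using (Prime; prime?; ¬prime[0]; ¬prime[1]; prime⇒nonZero; prime⇒irreducible; euclidsLemma; ¬prime⇒composite; composite)
open import Data.Nat.Coprimality using (prime⇒coprime; coprime-Bézout)
import Data.Nat.GCD as GCD
open import Data.Nat.Induction using (<-rec)
open import Data.Nat.ListAction using (product)
open import Data.Nat.Tactic.RingSolver using (solve-∀)
open import Data.Bool as Bool using (Bool; true; false; if_then_else_; _∨_)
open import Data.Bool.Properties using (∨-identityʳ)
open import Data.Fin.Subset as Subset using (Subset; ∣_∣; _∪_)
open import Data.Fin.Subset.Properties using (anySubset?)
open import Data.Vec.Properties using (lookup-map; lookup-zipWith; lookup∘tabulate)
open import Data.List using ([]; _∷_; map; upTo)
open import Data.List.Relation.Unary.All using (All; []; _∷_)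
open import Data.List.Relation.Unary.AllPairs using ([]; _∷_)
open import Data.List.Relation.Unary.Unique.Propositional using (Unique)
open import Data.List.Relation.Unary.Unique.Propositional.Properties using (upTo⁺)
open import Algebra.Properties.CommutativeMonoid.Sum +-0-commutativeMonoid using (sum; sum-init-last; ∑-distrib-+; ∑-comm)

does⇒ : ∀ {A : Set} (a? : Dec A) → does a? ≡ true → A
does⇒ (yes a) _ = a

does⇒¬ : ∀ {A : Set} (a? : Dec A) → does a? ≡ false → ¬ A
does⇒¬ (no ¬a) _ = ¬a

does-mono : ∀ {A B : Set} (a? : Dec A) (b? : Dec B) → (A → B) → does a? ≡ true → does b? ≡ true
does-mono (yes a) b? f _ = dec-true b? (f a)

-- Counting

sumFin≡sum : ∀ {n} (f : Fin n → ℕ) → sumFin n f ≡ sum f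
sumFin≡sum {zero}  f = refl
sumFin≡sum {suc n} f = cong (f zero +_) (sumFin≡sum (f ∘ suc))

sumFin-cong : ∀ {n} {f g : Fin n → ℕ} → (∀ i → f i ≡ g i) → sumFin n f ≡ sumFin n g
sumFin-cong {zero}  h = refl
sumFin-cong {suc n} h = cong₂ _+_ (h zero) (sumFin-cong (h ∘ suc))

sumFin-mono : ∀ {n} {f g : Fin n → ℕ} → (∀ i → f i ≤ g i) → sumFin n f ≤ sumFin n g
sumFin-mono {zero}  h = z≤n
sumFin-mono {suc n} h = +-mono-≤ (h zero) (sumFin-mono (h ∘ suc))

sumFin-const : ∀ n x → sumFin n (λ _ → x) ≡ n * x
sumFin-const zero    x = refl
sumFin-const (suc n) x = cong (x +_) (sumFin-const n x)

sumFin-*ʳ : ∀ {n} x (f : Fin n → ℕ) → sumFin n (λ i → f i * x) ≡ sumFin n f * x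
sumFin-*ʳ {zero}  x f = refl
sumFin-*ʳ {suc n} x f = trans (cong (f zero * x +_) (sumFin-*ʳ x (f ∘ suc))) (sym (*-distribʳ-+ x (f zero) _))

sumFin-distrib-+ : ∀ {n} (f g : Fin n → ℕ) → sumFin n (λ i → f i + g i) ≡ sumFin n f + sumFin n g
sumFin-distrib-+ f g = begin
  sumFin _ (λ i → f i + g i)  ≡⟨ sumFin≡sum (λ i → f i + g i) ⟩
  sum (λ i → f i + g i)       ≡⟨ ∑-distrib-+ f g ⟩
  sum f + sum g               ≡⟨ cong₂ _+_ (sumFin≡sum f) (sumFin≡sum g) ⟨
  sumFin _ f + sumFin _ g     ∎
  where open ≡-Reasoning

sumFin-swap : ∀ {m n} (f : Fin m → Fin n → ℕ) →
              sumFin m (λ i → sumFin n (f i)) ≡ sumFin n (λ j → sumFin m (λ i → f i j))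
sumFin-swap {m} {n} f = begin
  sumFin m (λ i → sumFin n (f i))          ≡⟨ sumFin-cong (λ i → sumFin≡sum (f i)) ⟩
  sumFin m (λ i → sum (f i))               ≡⟨ sumFin≡sum (λ i → sum (f i)) ⟩
  sum (λ i → sum (f i))                    ≡⟨ ∑-comm f ⟩
  sum (λ j → sum (λ i → f i j))            ≡⟨ sumFin≡sum (λ j → sum (λ i → f i j)) ⟨
  sumFin n (λ j → sum (λ i → f i j))       ≡⟨ sumFin-cong (λ j → sumFin≡sum (λ i → f i j)) ⟨
  sumFin n (λ j → sumFin m (λ i → f i j))  ∎
  where open ≡-Reasoning

sumFin-ω : ∀ {q} (f : Fin (suc q) → ℕ) → sumFin (suc q) (f ∘ ω) ≡ sumFin (suc q) f
sumFin-ω {q} f = begin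
  sumFin (suc q) (f ∘ ω)            ≡⟨ sumFin≡sum (f ∘ ω) ⟩
  f (fromℕ q) + sum (f ∘ inject₁)   ≡⟨ +-comm (f (fromℕ q)) _ ⟩
  sum (f ∘ inject₁) + f (fromℕ q)   ≡⟨ sum-init-last f ⟨
  sum f                             ≡⟨ sumFin≡sum f ⟨
  sumFin (suc q) f                  ∎
  where open ≡-Reasoning

sumFin-≡⇒≗ : ∀ {n} {f g : Fin n → ℕ} → (∀ i → f i ≤ g i) → sumFin n g ≤ sumFin n f → ∀ i → f i ≡ g i
sumFin-≡⇒≗ {suc n} {f} {g} f≤g Σg≤Σf = pointwise
  where
  tail-≤ : sumFin n (f ∘ suc) ≤ sumFin n (g ∘ suc)
  tail-≤ = sumFin-mono (f≤g ∘ suc)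
  pointwise : ∀ i → f i ≡ g i
  pointwise zero    = ≤-antisym (f≤g zero) (+-cancelʳ-≤ _ (g zero) (f zero) (≤-trans Σg≤Σf (+-monoʳ-≤ (f zero) tail-≤)))
  pointwise (suc i) = sumFin-≡⇒≗ (f≤g ∘ suc) (+-cancelˡ-≤ (g zero) _ _ (≤-trans Σg≤Σf (+-monoˡ-≤ _ (f≤g zero)))) i

bit : Bool → ℕ
bit x = if x then 1 else 0

bit-mono : ∀ {x y} → (x ≡ true → y ≡ true) → bit x ≤ bit y
bit-mono {false} h = z≤n
bit-mono {true}  h rewrite h refl = ≤-refl

bit-injective : ∀ {x y} → bit x ≡ bit y → x ≡ y
bit-injective {false} {false} _ = refl
bit-injective {true}  {true}  _ = refl

countTrue≡sumFin : ∀ {n} (f : Fin n → Bool) → countTrue n f ≡ sumFin n (bit ∘ f)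
countTrue≡sumFin {zero}  f = refl
countTrue≡sumFin {suc n} f = cong (bit (f zero) +_) (countTrue≡sumFin (f ∘ suc))

countTrue-cong : ∀ {n} {f g : Fin n → Bool} → (∀ i → f i ≡ g i) → countTrue n f ≡ countTrue n g
countTrue-cong {zero}  h = refl
countTrue-cong {suc n} h = cong₂ _+_ (cong bit (h zero)) (countTrue-cong (h ∘ suc))

countTrue-mono : ∀ {n} {f g : Fin n → Bool} → (∀ i → f i ≡ true → g i ≡ true) → countTrue n f ≤ countTrue n g
countTrue-mono {zero}  h = z≤n
countTrue-mono {suc n} h = +-mono-≤ (bit-mono (h zero)) (countTrue-mono (h ∘ suc))

countTrue-≡⇒≗ : ∀ {n} {f g : Fin n → Bool} → (∀ i → f i ≡ true → g i ≡ true) →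
                countTrue n f ≡ countTrue n g → ∀ i → f i ≡ g i
countTrue-≡⇒≗ {f = f} {g} f⇒g eq i = bit-injective (sumFin-≡⇒≗ (λ i → bit-mono (f⇒g i))
  (≤-reflexive (trans (sym (countTrue≡sumFin g)) (trans (sym eq) (countTrue≡sumFin f)))) i)

countTrue≤n : ∀ {n} (f : Fin n → Bool) → countTrue n f ≤ n
countTrue≤n {zero}  f = z≤n
countTrue≤n {suc n} f = +-mono-≤ (bit-mono {f zero} (λ _ → refl)) (countTrue≤n (f ∘ suc))

countTrue-positive : ∀ {n} (f : Fin n → Bool) i → f i ≡ true → 0 < countTrue n f
countTrue-positive f zero    eq rewrite eq = s≤s z≤n
countTrue-positive f (suc i) eq = ≤-trans (countTrue-positive (f ∘ suc) i eq) (m≤n+m _ (bit (f zero)))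

countTrue-true : ∀ n → countTrue n (λ _ → true) ≡ n
countTrue-true zero    = refl
countTrue-true (suc n) = cong suc (countTrue-true n)

countTrue-false : ∀ n → countTrue n (λ _ → false) ≡ 0
countTrue-false zero    = refl
countTrue-false (suc n) = countTrue-false n

countTrue-proper : ∀ {n} (f : Fin (suc n) → Bool) → ¬ (∀ i → f i ≡ true) → countTrue (suc n) f ≤ n
countTrue-proper f ¬all with m≤n⇒m<n∨m≡n (countTrue≤n f)
... | inj₁ <n = s≤s⁻¹ <n
... | inj₂ ≡n = ⊥-elim (¬all (countTrue-≡⇒≗ (λ _ _ → refl) (trans ≡n (sym (countTrue-true _)))))

countTrue-ω : ∀ {q} (f g : Fin (suc q) → Bool) → (∀ i → g (ω i) ≡ f i) → countTrue (suc q) g ≡ countTrue (suc q) f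
countTrue-ω f g h = begin
  countTrue _ g           ≡⟨ countTrue≡sumFin g ⟩
  sumFin _ (bit ∘ g)      ≡⟨ sumFin-ω (bit ∘ g) ⟨
  sumFin _ (bit ∘ g ∘ ω)  ≡⟨ sumFin-cong (cong bit ∘ h) ⟩
  sumFin _ (bit ∘ f)      ≡⟨ countTrue≡sumFin f ⟨
  countTrue _ f           ∎
  where open ≡-Reasoning

∣∣≡countTrue : ∀ {n} (B : Subset n) → ∣ B ∣ ≡ countTrue n (lookup B)
∣∣≡countTrue []          = refl
∣∣≡countTrue (true ∷ B)  = cong suc (∣∣≡countTrue B)
∣∣≡countTrue (false ∷ B) = ∣∣≡countTrue B

sumFin-positive : ∀ {n} (f : Fin n → ℕ) i → 0 < f i → 0 < sumFin n f
sumFin-positive f zero    h = ≤-trans h (m≤m+n _ _)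
sumFin-positive f (suc i) h = ≤-trans (sumFin-positive (f ∘ suc) i h) (m≤n+m _ (f zero))

subset-of-size : ∀ {n} k (f : Fin n → Bool) → k ≤ countTrue n f →
                 ∃ λ (B : Subset n) → ∣ B ∣ ≡ k × (∀ i → lookup B i ≡ true → f i ≡ true)
subset-of-size {zero}  zero    f h = [] , refl , λ ()
subset-of-size {suc n} k       f h with f zero in f₀
subset-of-size {suc n} k       f h | false with subset-of-size k (f ∘ suc) h
... | B , size , B⊆f = false ∷ B , size , λ { zero () ; (suc i) → B⊆f i }
subset-of-size {suc n} zero    f h | true with subset-of-size zero (f ∘ suc) z≤n
... | B , size , B⊆f = false ∷ B , size , λ { zero () ; (suc i) → B⊆f i }
subset-of-size {suc n} (suc k) f h | true with subset-of-size k (f ∘ suc) (s≤s⁻¹ h)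
... | B , size , B⊆f = true ∷ B , cong suc size , λ { zero _ → f₀ ; (suc i) → B⊆f i }

countTrue-∨ : ∀ {n} (f g : Fin n → Bool) → countTrue n (λ i → f i ∨ g i) ≤ countTrue n f + countTrue n g
countTrue-∨ {zero}  f g = z≤n
countTrue-∨ {suc n} f g = begin
  bit (f zero ∨ g zero) + countTrue n (λ i → f (suc i) ∨ g (suc i))
    ≤⟨ +-mono-≤ (bit-∨ (f zero) (g zero)) (countTrue-∨ (f ∘ suc) (g ∘ suc)) ⟩
  (bit (f zero) + bit (g zero)) + (countTrue n (f ∘ suc) + countTrue n (g ∘ suc))
    ≡⟨ interchange (bit (f zero)) (bit (g zero)) _ _ ⟩
  countTrue (suc n) f + countTrue (suc n) g ∎
  where
  open ≤-Reasoning
  interchange : ∀ a b c d → (a + b) + (c + d) ≡ (a + c) + (b + d)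
  interchange = solve-∀
  bit-∨ : ∀ x y → bit (x ∨ y) ≤ bit x + bit y
  bit-∨ true  y = s≤s z≤n
  bit-∨ false y = ≤-refl

countTrue-∨-disjoint : ∀ {n} (f g : Fin n → Bool) → (∀ i → f i ≡ true → g i ≡ false) →
                       countTrue n (λ i → f i ∨ g i) ≡ countTrue n f + countTrue n g
countTrue-∨-disjoint {zero}  f g h = refl
countTrue-∨-disjoint {suc n} f g h with f zero | g zero | h zero
... | true  | true  | h₀ with () ← h₀ refl
... | true  | false | _ = cong suc (countTrue-∨-disjoint (f ∘ suc) (g ∘ suc) (h ∘ suc))
... | false | true  | _ = trans (cong suc (countTrue-∨-disjoint (f ∘ suc) (g ∘ suc) (h ∘ suc))) (sym (+-suc _ _))
... | false | false | _ = countTrue-∨-disjoint (f ∘ suc) (g ∘ suc) (h ∘ suc)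

-- Equivariant choice from proper nonempty subsets of a cyclic group of prime order

toℕ-mod : ∀ m n .{{_ : NonZero n}} → toℕ (m mod n) ≡ m % n
toℕ-mod m n = Fin.toℕ-fromℕ< (m%n<n m n)

mod-+-* : ∀ m k n .{{_ : NonZero n}} → (m + k * n) mod n ≡ m mod n
mod-+-* m k n = Fin.toℕ-injective (trans (toℕ-mod (m + k * n) n) (trans ([m+kn]%n≡m%n m k n) (sym (toℕ-mod m n))))

suc-% : ∀ m q → m % suc q ≢ q → suc m % suc q ≡ suc (m % suc q)
suc-% m q ≢q = begin
  suc m % suc q                                  ≡⟨ cong (λ x → suc x % suc q) (m≡m%n+[m/n]*n m (suc q)) ⟩
  (suc (m % suc q) + m / suc q * suc q) % suc q  ≡⟨ [m+kn]%n≡m%n (suc (m % suc q)) (m / suc q) (suc q) ⟩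
  suc (m % suc q) % suc q                        ≡⟨ m<n⇒m%n≡m (s≤s (≤∧≢⇒< (s≤s⁻¹ (m%n<n m (suc q))) ≢q)) ⟩
  suc (m % suc q)                                ∎
  where open ≡-Reasoning

-- Stated additively: only `zero` wraps around, which costs one multiple of `suc q`.
toℕ-ω : ∀ {q} (i : Fin (suc q)) → suc (toℕ (ω i)) ≡ toℕ i + bit (does (i Fin.≟ zero)) * suc q
toℕ-ω {q} zero    = trans (cong suc (Fin.toℕ-fromℕ q)) (sym (+-identityʳ (suc q)))
toℕ-ω     (suc i) = trans (cong suc (Fin.toℕ-inject₁ i)) (sym (+-identityʳ _))

ω-suc-mod : ∀ m q → ω (suc m mod suc q) ≡ m mod suc q
ω-suc-mod m q = Fin.toℕ-injective (trans (by-cases _ refl) (sym (toℕ-mod m (suc q))))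
  where
  by-cases : ∀ i → i ≡ suc m mod suc q → toℕ (ω i) ≡ m % suc q
  by-cases zero    eq = trans (Fin.toℕ-fromℕ q) (sym (%-pred-≡0 {m} {suc q} (trans (sym (toℕ-mod (suc m) (suc q))) (cong toℕ (sym eq)))))
  by-cases (suc i) eq with m % suc q ≟ q
  ... | yes ≡q = ⊥-elim (1+n≢0 (trans (cong toℕ eq) (trans (toℕ-mod (suc m) (suc q)) wraps)))
    where
    open ≡-Reasoning
    wraps : suc m % suc q ≡ 0
    wraps = begin
      suc m % suc q                                  ≡⟨ cong (λ x → suc x % suc q) (m≡m%n+[m/n]*n m (suc q)) ⟩
      (suc (m % suc q) + m / suc q * suc q) % suc q  ≡⟨ [m+kn]%n≡m%n (suc (m % suc q)) (m / suc q) (suc q) ⟩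
      suc (m % suc q) % suc q                        ≡⟨ cong (λ x → suc x % suc q) ≡q ⟩
      suc q % suc q                                  ≡⟨ n%n≡0 (suc q) ⟩
      0                                              ∎
  ... | no ≢q = trans (Fin.toℕ-inject₁ i)
                      (suc-injective (trans (cong toℕ eq) (trans (toℕ-mod (suc m) (suc q)) (suc-% m q ≢q))))

module Choice (q : ℕ) (isPrime : Prime (suc q)) where

  p : ℕ
  p = suc q

  inverse : ∀ a → 0 < a → a < p → ∃₂ λ u t → u * a ≡ 1 + t * p
  inverse a 0<a a<p with coprime-Bézout (prime⇒coprime isPrime {{>-nonZero 0<a}} a<p)
  ... | GCD.Bézout.-+ x y eq = y , x , sym eq
  ... | GCD.Bézout.+- zero y ()
  -- Here `y * a` is -1 modulo `p`, and so is `q`; hence `y * q` is an inverse of `a`.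
  ... | GCD.Bézout.+- (suc x) y eq = y * q , from-negative q refl
    where
    open ≡-Reasoning
    expand : ∀ y q′ a → y * suc q′ * a + suc q′ ≡ suc q′ * (1 + y * a)
    expand = solve-∀
    collect : ∀ q′ x → suc q′ * (suc x * suc (suc q′)) ≡ (1 + (x + q′ * suc x) * suc (suc q′)) + suc q′
    collect = solve-∀
    from-negative : ∀ q′ → q′ ≡ q → ∃ λ t → y * q * a ≡ 1 + t * p
    from-negative zero     refl = ⊥-elim (¬prime[1] isPrime)
    from-negative (suc q′) refl = x + q′ * suc x , +-cancelʳ-≡ (suc q′) _ _ (begin
      y * suc q′ * a + suc q′                              ≡⟨ expand y q′ a ⟩
      suc q′ * (1 + y * a)                                 ≡⟨ cong (suc q′ *_) eq ⟩
      suc q′ * (suc x * suc (suc q′))                      ≡⟨ collect q′ x ⟩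
      (1 + (x + q′ * suc x) * suc (suc q′)) + suc q′       ∎)

  -- Junk value 0 outside 0 < a < p.
  inv : ℕ → ℕ
  inv a with 0 <? a | a <? p
  ... | yes 0<a | yes a<p = proj₁ (inverse a 0<a a<p)
  ... | _       | _       = 0

  inv-inverse : ∀ a → 0 < a → a < p → ∃ λ t → inv a * a ≡ 1 + t * p
  inv-inverse a 0<a a<p with 0 <? a | a <? p
  ... | yes 0<a′ | yes a<p′ = proj₂ (inverse a 0<a′ a<p′)
  ... | no ¬0<a  | _        = ⊥-elim (¬0<a 0<a)
  ... | yes _    | no ¬a<p  = ⊥-elim (¬a<p a<p)

  weight : (Fin p → Bool) → ℕ
  weight S = sumFin p (λ g → bit (S g) * toℕ g)

  -- The average of the elements of S: rotating S by one shifts the sum of its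
  -- elements by |S|, which is invertible modulo p.
  pick : (Fin p → Bool) → Fin p
  pick S = (inv (countTrue p S) * weight S) mod p

  pick-cong : ∀ {S T} → (∀ g → S g ≡ T g) → pick S ≡ pick T
  pick-cong h = cong₂ (λ c w → (inv c * w) mod p) (countTrue-cong h) (sumFin-cong λ g → cong (λ x → bit x * toℕ g) (h g))

  weight-rot : ∀ S T → (∀ g → T (ω g) ≡ S g) → ∃ λ t → weight T + countTrue p S ≡ weight S + t * p
  -- Only the element `zero` wraps around, so a multiple of `p` is gained exactly if `zero` lies in
  -- `S`.
  weight-rot S T h = bit (S zero) , (begin
    weight T + countTrue p S
      ≡⟨ cong₂ _+_ (sym (sumFin-ω (λ g → bit (T g) * toℕ g))) (countTrue≡sumFin S) ⟩
    sumFin p (λ g → bit (T (ω g)) * toℕ (ω g)) + sumFin p (bit ∘ S)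
      ≡⟨ cong (_+ sumFin p (bit ∘ S)) (sumFin-cong λ g → cong (λ x → bit x * toℕ (ω g)) (h g)) ⟩
    sumFin p (λ g → bit (S g) * toℕ (ω g)) + sumFin p (bit ∘ S)
      ≡⟨ sumFin-distrib-+ (λ g → bit (S g) * toℕ (ω g)) (bit ∘ S) ⟨
    sumFin p (λ g → bit (S g) * toℕ (ω g) + bit (S g))
      ≡⟨ sumFin-cong (λ g → trans (trans (+-comm _ (bit (S g))) (sym (*-suc (bit (S g)) _))) (cong (bit (S g) *_) (toℕ-ω g))) ⟩
    sumFin p (λ g → bit (S g) * (toℕ g + bit (does (g Fin.≟ zero)) * p))
      ≡⟨ sumFin-cong (λ g → *-distribˡ-+ (bit (S g)) (toℕ g) (bit (does (g Fin.≟ zero)) * p)) ⟩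
    sumFin p (λ g → bit (S g) * toℕ g + bit (S g) * (bit (does (g Fin.≟ zero)) * p))
      ≡⟨ sumFin-distrib-+ (λ g → bit (S g) * toℕ g) (λ g → bit (S g) * (bit (does (g Fin.≟ zero)) * p)) ⟩
    weight S + sumFin p (λ g → bit (S g) * (bit (does (g Fin.≟ zero)) * p))
      ≡⟨ cong (weight S +_) (cong₂ _+_ (cong (bit (S zero) *_) (*-identityˡ p))
           (trans (sumFin-cong λ g → *-zeroʳ (bit (S (suc g)))) (trans (sumFin-const q 0) (*-zeroʳ q)))) ⟩
    weight S + (bit (S zero) * p + 0)
      ≡⟨ cong (weight S +_) (+-identityʳ _) ⟩
    weight S + bit (S zero) * p ∎)
    where open ≡-Reasoning

  -- A size strictly between 0 and `p` has an inverse `u` modulo `p`; multiplying the shift of the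
  -- weight by `u` turns it into a shift by one.
  pick-rot : ∀ S T → (∀ g → T (ω g) ≡ S g) → 0 < countTrue p S → countTrue p S < p → pick T ≡ ω (pick S)
  pick-rot S T h 0<S S<p with weight-rot S T h | inv-inverse (countTrue p S) 0<S S<p
  ... | t , shift | t′ , unit = begin
    (inv (countTrue p T) * weight T) mod p            ≡⟨ cong (λ c → (inv c * weight T) mod p) (countTrue-ω S T h) ⟩
    (u * weight T) mod p                              ≡⟨ mod-+-* (u * weight T) t′ p ⟨
    (u * weight T + t′ * p) mod p                     ≡⟨ ω-suc-mod (u * weight T + t′ * p) q ⟨
    ω (suc (u * weight T + t′ * p) mod p)             ≡⟨ cong (λ x → ω (x mod p)) step ⟩
    ω ((u * weight S + u * t * p) mod p)              ≡⟨ cong ω (mod-+-* (u * weight S) (u * t) p) ⟩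
    ω ((u * weight S) mod p)                          ∎
    where
    open ≡-Reasoning
    u : ℕ
    u = inv (countTrue p S)
    step : suc (u * weight T + t′ * p) ≡ u * weight S + u * t * p
    step = begin
      suc (u * weight T + t′ * p)            ≡⟨ +-suc (u * weight T) (t′ * p) ⟨
      u * weight T + (1 + t′ * p)            ≡⟨ cong (u * weight T +_) unit ⟨
      u * weight T + u * countTrue p S       ≡⟨ *-distribˡ-+ u (weight T) _ ⟨
      u * (weight T + countTrue p S)         ≡⟨ cong (u *_) shift ⟩
      u * (weight S + t * p)                 ≡⟨ *-distribˡ-+ u (weight S) _ ⟩
      u * weight S + u * (t * p)             ≡⟨ cong (u * weight S +_) (*-assoc u t p) ⟨
      u * weight S + u * t * p               ∎

  Family : ℕ → Set
  Family n = Fin n → Fin p → Bool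

  total : ∀ {n} → Family n → ℕ
  total {n} Q = sumFin n (λ i → countTrue p (Q i))

  -- The first nonempty set decides. Rotation preserves sizes, so it does not change which set this
  -- is. The value `zero` is a default for families of empty sets.
  choose : ∀ {n} → Family n → Fin p
  choose {zero}  Q = zero
  choose {suc n} Q with countTrue p (Q zero) ≟ 0
  ... | yes _ = choose (Q ∘ suc)
  ... | no  _ = pick (Q zero)

  total-rot : ∀ {n} (Q R : Family n) → (∀ i g → R i (ω g) ≡ Q i g) → total R ≡ total Q
  total-rot Q R h = sumFin-cong λ i → countTrue-ω (Q i) (R i) (h i)

  choose-rot : ∀ {n} (Q R : Family n) → (∀ i g → R i (ω g) ≡ Q i g) → (∀ i → countTrue p (Q i) < p) →
               0 < total Q → choose R ≡ ω (choose Q)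
  choose-rot {suc n} Q R h Q<p 0<Q with countTrue p (Q zero) ≟ 0 | countTrue p (R zero) ≟ 0
  ... | yes Q≡0 | yes R≡0 = choose-rot (Q ∘ suc) (R ∘ suc) (h ∘ suc) (Q<p ∘ suc) (subst (λ x → 0 < x + total (Q ∘ suc)) Q≡0 0<Q)
  ... | yes Q≡0 | no  R≢0 = ⊥-elim (R≢0 (trans (countTrue-ω (Q zero) (R zero) (h zero)) Q≡0))
  ... | no  Q≢0 | yes R≡0 = ⊥-elim (Q≢0 (trans (sym (countTrue-ω (Q zero) (R zero) (h zero))) R≡0))
  ... | no  Q≢0 | no  R≢0 = pick-rot (Q zero) (R zero) (h zero) (n≢0⇒n>0 Q≢0) (Q<p zero)

  choose-cong : ∀ {n} (Q R : Family n) → (∀ i g → Q i g ≡ R i g) → choose Q ≡ choose R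
  choose-cong {zero}  Q R h = refl
  choose-cong {suc n} Q R h with countTrue p (Q zero) ≟ 0 | countTrue p (R zero) ≟ 0
  ... | yes Q≡0 | yes R≡0 = choose-cong (Q ∘ suc) (R ∘ suc) (h ∘ suc)
  ... | yes Q≡0 | no  R≢0 = ⊥-elim (R≢0 (trans (sym (countTrue-cong (h zero))) Q≡0))
  ... | no  Q≢0 | yes R≡0 = ⊥-elim (Q≢0 (trans (countTrue-cong (h zero)) R≡0))
  ... | no  Q≢0 | no  R≢0 = pick-cong (h zero)

  -- Inclusions with equal total size are equalities, so the two families coincide.
  choose-monotone : ∀ {n} (Q R : Family n) → (∀ i g → Q i g ≡ true → R i g ≡ true) → total Q ≡ total R → choose Q ≡ choose R
  choose-monotone Q R Q⊆R eq = choose-cong Q R λ i →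
    countTrue-≡⇒≗ (Q⊆R i) (sumFin-≡⇒≗ (λ i → countTrue-mono (Q⊆R i)) (≤-reflexive (sym eq)) i)

-- The positive form of a failure of properness. Colourings act on all subsets, so that no proofs of
-- size have to be carried along; only the colours of `k`-sets enter.
Monochromatic : ∀ {n m} (r k : ℕ) (s : Fin n → ℕ) (col : Subset n → Fin m) → Set
Monochromatic {n} {m} r k s col = ∃₂ λ (A : Fin r → Subset n) (c : Fin m) →
  (∀ j → ∣ A j ∣ ≡ k) × (∀ j → col (A j) ≡ c) × (∀ i → countTrue r (λ j → lookup (A j) i) ≤ s i)

-- The prime case

-- The coordinate of the `a`-th copy of `i`, when the copies are laid out block by block.
embed : ∀ {n} (s : Fin n → ℕ) (i : Fin n) → Fin (s i) → Fin (sumFin n s)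
embed s zero    a = a ↑ˡ _
embed s (suc i) a = s zero ↑ʳ embed (s ∘ suc) i a

embed-surjective : ∀ {n} (s : Fin n → ℕ) x → ∃₂ λ i a → embed s i a ≡ x
embed-surjective {suc n} s x with splitAt (s zero) x in eq
... | inj₁ a = zero , a , Fin.splitAt⁻¹-↑ˡ eq
... | inj₂ y with embed-surjective (s ∘ suc) y
...   | i , a , refl = suc i , a , Fin.splitAt⁻¹-↑ʳ eq

_≟ᴹ_ : ∀ {q} (x y : Maybe (Fin q)) → Dec (x ≡ y)
_≟ᴹ_ = Maybe.≡-dec Fin._≟_

countTrue-image : ∀ {q t} (f : Fin t → Maybe (Fin q)) →
                  countTrue q (λ g → does (any? λ a → f a ≟ᴹ just g)) ≤ t
countTrue-image {q} {zero}  f = ≤-reflexive (countTrue-false q)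
countTrue-image {q} {suc t} f = begin
  countTrue q (λ g → does (f zero ≟ᴹ just g) ∨ does (any? λ a → f (suc a) ≟ᴹ just g))
    ≤⟨ countTrue-∨ (λ g → does (f zero ≟ᴹ just g)) _ ⟩
  countTrue q (λ g → does (f zero ≟ᴹ just g)) + countTrue q (λ g → does (any? λ a → f (suc a) ≟ᴹ just g))
    ≤⟨ +-mono-≤ (single (f zero)) (countTrue-image (f ∘ suc)) ⟩
  suc t ∎
  where
  open ≤-Reasoning
  single : ∀ {q} (x : Maybe (Fin q)) → countTrue q (λ g → does (x ≟ᴹ just g)) ≤ 1
  single {zero}  x              = z≤n
  single {suc q} nothing        = single {q} nothing
  single {suc q} (just zero)    = s≤s (≤-reflexive (countTrue-false q))
  single {suc q} (just (suc h)) = single (just h)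

-- The sets have `suc k` elements, so `k` is the k - 1 of the theorem. By `s≤q`, no element has
-- enough copies to carry all `p` signs.
module PrimeCase {q n m : ℕ} (isPrime : Prime (suc q)) (k : ℕ) (s : Fin n → ℕ) (s≤q : ∀ i → s i ≤ q)
                 (col : Subset n → Fin m) where

  open Join q
  open Choice q isPrime

  N : ℕ
  N = sumFin n s

  Signs : Cell N → Fin n → Fin p → Set
  Signs X i g = ∃ λ a → lookup X (embed s i a) ≡ just g

  Signs? : ∀ X i g → Dec (Signs X i g)
  Signs? X i g = any? λ a → lookup X (embed s i a) ≟ᴹ just g

  signs : Cell N → Family n
  signs X i g = does (Signs? X i g)

  Candidate : Cell N → Fin m → Fin p → Subset n → Set
  Candidate X c g B = ∣ B ∣ ≡ suc k × (∀ i → lookup B i ≡ true → Signs X i g) × col B ≡ c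

  Coloured : Cell N → Fin m → Fin p → Set
  Coloured X c g = ∃ (Candidate X c g)

  Coloured? : ∀ X c g → Dec (Coloured X c g)
  Coloured? X c g = anySubset? λ B →
    (∣ B ∣ ≟ suc k) ×-dec all? (λ i → (lookup B i Bool.≟ true) →-dec Signs? X i g) ×-dec (col B Fin.≟ c)

  colours : Cell N → Family m
  colours X c g = does (Coloured? X c g)

  Small : Cell N → Set
  Small X = ∀ g → countTrue n (λ i → signs X i g) ≤ k

  Small? : ∀ X → Dec (Small X)
  Small? X = all? λ g → countTrue n (λ i → signs X i g) ≤? k

  lookup-rot : ∀ {N} (X : Cell N) x g → (lookup X x ≡ just g) ⇔ (lookup (rot X) x ≡ just (ω g))
  lookup-rot X x g = mk⇔ (λ eq → trans (lookup-map x _ X) (cong (Maybe.map ω) eq))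
                         (λ eq → back (lookup X x) (trans (sym (lookup-map x _ X)) eq))
    where
    back : ∀ y → Maybe.map ω y ≡ just (ω g) → y ≡ just g
    back (just h) eq = cong just (ω-injective (Maybe.just-injective eq))

  Signs-rot : ∀ X i g → Signs (rot X) i (ω g) ⇔ Signs X i g
  Signs-rot X i g = mk⇔ (λ (a , eq) → a , Equivalence.from (lookup-rot X (embed s i a) g) eq)
                        (λ (a , eq) → a , Equivalence.to (lookup-rot X (embed s i a) g) eq)

  signs-rot : ∀ X i g → signs (rot X) i (ω g) ≡ signs X i g
  signs-rot X i g = does-⇔ (Signs-rot X i g) (Signs? (rot X) i (ω g)) (Signs? X i g)

  colours-rot : ∀ X c g → colours (rot X) c (ω g) ≡ colours X c g
  colours-rot X c g = does-⇔
    (mk⇔ (λ (B , size , B⊆ , eq) → B , size , (λ i e → Equivalence.to (Signs-rot X i g) (B⊆ i e)) , eq)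
         (λ (B , size , B⊆ , eq) → B , size , (λ i e → Equivalence.from (Signs-rot X i g) (B⊆ i e)) , eq))
    (Coloured? (rot X) c (ω g)) (Coloured? X c g)

  Small-rot⁺ : ∀ X → Small X → Small (rot X)
  Small-rot⁺ X small g with ω-surjective g
  ... | h , refl = subst (_≤ k) (countTrue-cong (λ i → sym (signs-rot X i h))) (small h)

  Small-rot⁻ : ∀ X → Small (rot X) → Small X
  Small-rot⁻ X small g = subst (_≤ k) (countTrue-cong (λ i → signs-rot X i g)) (small (ω g))

  module _ (X Y : Cell N) (X⊑Y : X ⊑ Y) where

    Signs-mono : ∀ i g → Signs X i g → Signs Y i g
    Signs-mono i g (a , eq) = a , X⊑Y _ g eq

    signs-mono : ∀ i g → signs X i g ≡ true → signs Y i g ≡ true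
    signs-mono i g = does-mono (Signs? X i g) (Signs? Y i g) (Signs-mono i g)

    colours-mono : ∀ c g → colours X c g ≡ true → colours Y c g ≡ true
    colours-mono c g = does-mono (Coloured? X c g) (Coloured? Y c g)
      λ (B , size , B⊆ , eq) → B , size , (λ i e → Signs-mono i g (B⊆ i e)) , eq

  signs-count : ∀ X i → countTrue p (signs X i) ≤ s i
  signs-count X i = countTrue-image (λ a → lookup X (embed s i a))

  signs-positive : ∀ X → NonEmpty X → 0 < total (signs X)
  signs-positive X (x , g , eq) with embed-surjective s x
  ... | i , a , refl = sumFin-positive _ i (countTrue-positive (signs X i) g (dec-true (Signs? X i g) (a , eq)))

  -- Double counting: for each of the `p` signs, the elements carrying it number at most `k`.
  signs-total : ∀ X → Small X → total (signs X) ≤ p * k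
  signs-total X small = begin
    sumFin n (λ i → countTrue p (signs X i))                ≡⟨ sumFin-cong (λ i → countTrue≡sumFin (signs X i)) ⟩
    sumFin n (λ i → sumFin p (λ g → bit (signs X i g)))     ≡⟨ sumFin-swap (λ i g → bit (signs X i g)) ⟩
    sumFin p (λ g → sumFin n (λ i → bit (signs X i g)))     ≡⟨ sumFin-cong (λ g → countTrue≡sumFin (λ i → signs X i g)) ⟨
    sumFin p (λ g → countTrue n (λ i → signs X i g))        ≤⟨ sumFin-mono small ⟩
    sumFin p (λ _ → k)                                      ≡⟨ sumFin-const p k ⟩
    p * k                                                   ∎
    where open ≤-Reasoning

  colours-positive : ∀ X → ¬ Small X → 0 < total (colours X)
  colours-positive X ¬small with Fin.¬∀⟶∃¬ p _ (λ g → countTrue n (λ i → signs X i g) ≤? k) ¬small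
  ... | g , large with subset-of-size (suc k) (λ i → signs X i g) (≰⇒> large)
  ...   | B , size , B⊆ = sumFin-positive _ (col B) (countTrue-positive (colours X (col B)) g
            (dec-true (Coloured? X (col B) g) (B , size , (λ i e → does⇒ (Signs? X i g) (B⊆ i e)) , refl)))

  -- By `none`, no colour occurs with all signs. So each colour adds at most `q` to the level, and
  -- the sets `colours X c` are proper, as the equivariance of `choose` requires.
  module _ (none : ¬ (∃₂ λ X c → ∀ g → Coloured X c g)) where

    colours-count : ∀ X c → countTrue p (colours X c) ≤ q
    colours-count X c = countTrue-proper (colours X c) λ all → none (X , c , λ g → does⇒ (Coloured? X c g) (all g))

    colours-total : ∀ X → total (colours X) ≤ q * m
    colours-total X = ≤-trans (sumFin-mono (colours-count X)) (≤-reflexive (trans (sumFin-const m q) (*-comm m q)))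

    level : Cell N → ℕ
    level X with Small? X
    ... | yes _ = total (signs X)
    ... | no  _ = p * k + total (colours X)

    sign : Cell N → Fin p
    sign X with Small? X
    ... | yes _ = choose (signs X)
    ... | no  _ = choose (colours X)

    level< : q * m + p * k < N → ∀ X → level X < N
    level< bound X with Small? X
    ... | yes small = ≤-<-trans (≤-trans (signs-total X small) (m≤n+m _ (q * m))) bound
    ... | no  _     = ≤-<-trans (≤-trans (+-monoʳ-≤ (p * k) (colours-total X)) (≤-reflexive (+-comm (p * k) _))) bound

    level> : ∀ X → NonEmpty X → 0 < level X
    level> X ne with Small? X
    ... | yes _     = signs-positive X ne
    ... | no ¬small = ≤-trans (colours-positive X ¬small) (m≤n+m _ (p * k))

    level-rot : ∀ X → NonEmpty X → level (rot X) ≡ level X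
    level-rot X ne with Small? X | Small? (rot X)
    ... | yes _ | yes _ = total-rot (signs X) (signs (rot X)) (signs-rot X)
    ... | yes s | no ¬s = ⊥-elim (¬s (Small-rot⁺ X s))
    ... | no ¬s | yes s = ⊥-elim (¬s (Small-rot⁻ X s))
    ... | no _  | no _  = cong (p * k +_) (total-rot (colours X) (colours (rot X)) (colours-rot X))

    sign-rot : ∀ X → NonEmpty X → sign (rot X) ≡ ω (sign X)
    sign-rot X ne with Small? X | Small? (rot X)
    ... | yes _ | yes _ = choose-rot (signs X) (signs (rot X)) (signs-rot X)
                            (λ i → s≤s (≤-trans (signs-count X i) (s≤q i))) (signs-positive X ne)
    ... | yes s | no ¬s = ⊥-elim (¬s (Small-rot⁺ X s))
    ... | no ¬s | yes s = ⊥-elim (¬s (Small-rot⁻ X s))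
    ... | no ¬s | no _  = choose-rot (colours X) (colours (rot X)) (colours-rot X)
                            (λ c → s≤s (colours-count X c)) (colours-positive X ¬s)

    -- Small cells have level at most `p * k` and all others a larger one, so equal levels put both
    -- cells in the same case.
    sign-coherent : ∀ X Y → NonEmpty X → X ⊑ Y → level X ≡ level Y → sign X ≡ sign Y
    sign-coherent X Y ne X⊑Y eq with Small? X | Small? Y
    ... | yes _ | yes _ = choose-monotone (signs X) (signs Y) (signs-mono X Y X⊑Y) eq
    ... | yes s | no ¬s = ⊥-elim (<⇒≢ (≤-<-trans (signs-total X s) (m<m+n (p * k) (colours-positive Y ¬s))) eq)
    ... | no ¬s | yes s = ⊥-elim (<⇒≢ (≤-<-trans (signs-total Y s) (m<m+n (p * k) (colours-positive X ¬s))) (sym eq))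
    ... | no _  | no _  = choose-monotone (colours X) (colours Y) (colours-mono X Y X⊑Y) (+-cancelˡ-≡ (p * k) _ _ eq)

    contradictory : q * m + p * k < N → ⊥
    contradictory bound with no-labelling level sign (level< bound) level> level-rot sign-rot sign-coherent
    ... | refl = ¬prime[1] isPrime

  -- The search over finitely many cells turns the contradiction into an explicit hyperedge.
  anyCell? : ∀ {N} {P : Cell N → Set} → Decidable P → Dec (∃ P)
  anyCell? {zero}  P? = map′ ([] ,_) (λ { ([] , Px) → Px }) (P? [])
  anyCell? {suc N} {P} P? = map′ to from
    (anyCell? (λ X → P? (nothing ∷ X)) ⊎-dec any? (λ g → anyCell? (λ X → P? (just g ∷ X))))
    where
    to : ∃ (λ X → P (nothing ∷ X)) ⊎ ∃₂ (λ g X → P (just g ∷ X)) → ∃ P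
    to (inj₁ (X , Px))     = nothing ∷ X , Px
    to (inj₂ (g , X , Px)) = just g ∷ X , Px
    from : ∃ P → ∃ (λ X → P (nothing ∷ X)) ⊎ ∃₂ (λ g X → P (just g ∷ X))
    from (nothing ∷ X , Px) = inj₁ (X , Px)
    from (just g ∷ X , Px)  = inj₂ (g , X , Px)

  monochromatic : q * m + p * k < N → Monochromatic p (suc k) s col
  monochromatic bound with anyCell? (λ X → any? (λ c → all? (Coloured? X c)))
  ... | no  none          = ⊥-elim (contradictory none bound)
  -- The set for `g` contains `i` only if a copy of `i` has sign `g`, and the `s i` copies carry at
  -- most `s i` signs.
  ... | yes (X , c , found) = (λ g → proj₁ (found g)) , c , (λ g → proj₁ (proj₂ (found g))) ,
          (λ g → proj₂ (proj₂ (proj₂ (found g)))) , λ i →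
          ≤-trans (countTrue-mono (λ g e → dec-true (Signs? X i g) (proj₁ (proj₂ (proj₂ (found g))) i e))) (signs-count X i)

-- The contrapositive of the bound, free of division, with `k` for k - 1. Equality s i = r is
-- allowed because the composite case applies the bounds for the factors to multiplicities that may
-- reach these factors.
KneserBound : ℕ → Set
KneserBound r = ∀ {n m} k (s : Fin n → ℕ) → (∀ i → s i ≤ r) → (col : Subset n → Fin m) →
                (r ∸ 1) * m + r * k < sumFin n s → Monochromatic r (suc k) s col

-- An element with s i ≡ p is unrestricted: it can be put into all the sets,
-- which lowers both sides of the bound by p.
prime-bound : ∀ {p} → Prime p → KneserBound p
prime-bound {zero}  isPrime = ⊥-elim (¬prime[0] isPrime)
prime-bound {suc q} isPrime {n} {m} k s s≤p col bound = by-cases (suc k ≤? countTrue n D)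
  where
  p : ℕ
  p = suc q
  D : Fin n → Bool
  D i = does (s i ≟ p)
  d : ℕ
  d = countTrue n D
  s⁰ : Fin n → ℕ
  s⁰ i = if D i then 0 else s i

  D-true : ∀ i → D i ≡ true → s i ≡ p
  D-true i = does⇒ (s i ≟ p)

  s⁰≤q : ∀ i → s⁰ i ≤ q
  s⁰≤q i with D i in eq
  ... | true  = z≤n
  ... | false = s≤s⁻¹ (≤∧≢⇒< (s≤p i) (does⇒¬ (s i ≟ p) eq))

  s-split : ∀ i → s i ≡ s⁰ i + bit (D i) * p
  s-split i with D i in eq
  ... | true  = trans (D-true i eq) (sym (*-identityˡ p))
  ... | false = sym (+-identityʳ (s i))

  Σs : sumFin n s ≡ sumFin n s⁰ + p * d
  Σs = begin
    sumFin n s                                       ≡⟨ sumFin-cong s-split ⟩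
    sumFin n (λ i → s⁰ i + bit (D i) * p)            ≡⟨ sumFin-distrib-+ s⁰ (λ i → bit (D i) * p) ⟩
    sumFin n s⁰ + sumFin n (λ i → bit (D i) * p)     ≡⟨ cong (sumFin n s⁰ +_) (sumFin-*ʳ p (bit ∘ D)) ⟩
    sumFin n s⁰ + sumFin n (bit ∘ D) * p             ≡⟨ cong (λ x → sumFin n s⁰ + x * p) (countTrue≡sumFin D) ⟨
    sumFin n s⁰ + d * p                              ≡⟨ cong (sumFin n s⁰ +_) (*-comm d p) ⟩
    sumFin n s⁰ + p * d                              ∎
    where open ≡-Reasoning

  by-cases : Dec (suc k ≤ d) → Monochromatic p (suc k) s col
  -- Elements of `D` may lie in all `p` sets, so one set inside `D` can be repeated `p` times.
  by-cases (yes k<d) with subset-of-size (suc k) D k<d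
  ... | B , size , B⊆D = (λ _ → B) , col B , (λ _ → size) , (λ _ → refl) , count
    where
    count : ∀ i → countTrue p (λ _ → lookup B i) ≤ s i
    count i with lookup B i in eq
    ... | true  = ≤-trans (countTrue≤n {p} (λ _ → true)) (≤-reflexive (sym (D-true i (B⊆D i eq))))
    ... | false = ≤-trans (≤-reflexive (countTrue-false p)) z≤n
  -- Lower the size by `d` and colour each set as its union with `D`. The sets found avoid `D`,
  -- where `s⁰` is zero, so adding `D` restores the size.
  by-cases (no k≮d) = extend (PrimeCase.monochromatic isPrime k′ s⁰ s⁰≤q (λ B → col (B ∪ tabulate D)) bound′)
    where
    k′ : ℕ
    k′ = k ∸ d
    k≡k′+d : k ≡ k′ + d
    k≡k′+d = sym (m∸n+n≡m (s≤s⁻¹ (≰⇒> k≮d)))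
    bound′ : q * m + p * k′ < sumFin n s⁰
    bound′ = +-cancelʳ-< (p * d) _ _ (subst₂ _<_ (trans (cong (λ x → q * m + p * x) k≡k′+d) (regroup (q * m) p k′ d)) Σs bound)
      where
      regroup : ∀ x p k d → x + p * (k + d) ≡ x + p * k + p * d
      regroup = solve-∀
    lookup-∪ : ∀ (B : Subset n) i → lookup (B ∪ tabulate D) i ≡ lookup B i ∨ D i
    lookup-∪ B i = trans (lookup-zipWith _∨_ i B (tabulate D)) (cong (lookup B i ∨_) (lookup∘tabulate D i))
    extend : Monochromatic p (suc k′) s⁰ (λ B → col (B ∪ tabulate D)) → Monochromatic p (suc k) s col
    extend (A , c , size , colour , count) = (λ j → A j ∪ tabulate D) , c , size′ , colour , count′
      where
      disjoint : ∀ j i → lookup (A j) i ≡ true → D i ≡ false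
      disjoint j i eq with D i | count i
      ... | true  | ≤0 = ⊥-elim (n≮0 (<-≤-trans (countTrue-positive (λ j → lookup (A j) i) j eq) ≤0))
      ... | false | _  = refl
      size′ : ∀ j → ∣ A j ∪ tabulate D ∣ ≡ suc k
      size′ j = begin
        ∣ A j ∪ tabulate D ∣                              ≡⟨ ∣∣≡countTrue (A j ∪ tabulate D) ⟩
        countTrue n (lookup (A j ∪ tabulate D))           ≡⟨ countTrue-cong (lookup-∪ (A j)) ⟩
        countTrue n (λ i → lookup (A j) i ∨ D i)          ≡⟨ countTrue-∨-disjoint (lookup (A j)) D (disjoint j) ⟩
        countTrue n (lookup (A j)) + d                    ≡⟨ cong (_+ d) (trans (sym (∣∣≡countTrue (A j))) (size j)) ⟩
        suc (k′ + d)                                      ≡⟨ cong suc k≡k′+d ⟨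
        suc k                                             ∎
        where open ≡-Reasoning
      count′ : ∀ i → countTrue p (λ j → lookup (A j ∪ tabulate D) i) ≤ s i
      count′ i with D i in eq | count i
      ... | true  | _  = ≤-trans (countTrue≤n (λ j → lookup (A j ∪ tabulate D) i)) (≤-reflexive (sym (D-true i eq)))
      ... | false | ≤s = subst (_≤ s i)
        (countTrue-cong λ j → sym (trans (lookup-∪ (A j) i) (trans (cong (lookup (A j) i ∨_) eq) (∨-identityʳ _)))) ≤s

-- Composite r

sumFin-↑ : ∀ m {n} (f : Fin (m + n) → ℕ) → sumFin (m + n) f ≡ sumFin m (λ i → f (i ↑ˡ n)) + sumFin n (λ j → f (m ↑ʳ j))
sumFin-↑ zero    f = refl
sumFin-↑ (suc m) f = trans (cong (f zero +_) (sumFin-↑ m (f ∘ suc))) (sym (+-assoc (f zero) _ _))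

sumFin-combine : ∀ n {t} (f : Fin (n * t) → ℕ) → sumFin (n * t) f ≡ sumFin n (λ i → sumFin t (λ a → f (combine i a)))
sumFin-combine zero        f = refl
sumFin-combine (suc n) {t} f = trans (sumFin-↑ t f) (cong (sumFin t (λ a → f (a ↑ˡ (n * t))) +_) (sumFin-combine n (λ x → f (t ↑ʳ x))))

countTrue-combine : ∀ n {t} (f : Fin (n * t) → Bool) → countTrue (n * t) f ≡ sumFin n (λ i → countTrue t (λ a → f (combine i a)))
countTrue-combine n {t} f = trans (countTrue≡sumFin f) (trans (sumFin-combine n (bit ∘ f))
  (sumFin-cong λ i → sym (countTrue≡sumFin (λ a → f (combine {n} {t} i a)))))

-- Greedy splitting of `x` into `t` summands capped at `c`.
piece : (c t x : ℕ) → Fin t → ℕ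
piece c (suc t) x zero    = x ⊓ c
piece c (suc t) x (suc a) = piece c t (x ∸ c) a

piece≤ : ∀ c t x a → piece c t x a ≤ c
piece≤ c (suc t) x zero    = m⊓n≤n x c
piece≤ c (suc t) x (suc a) = piece≤ c t (x ∸ c) a

sum-piece : ∀ c t x → x ≤ t * c → sumFin t (piece c t x) ≡ x
sum-piece c zero    x x≤0 = sym (n≤0⇒n≡0 x≤0)
sum-piece c (suc t) x x≤  = trans (cong₂ _+_ (⊓-comm x c) (sum-piece c t (x ∸ c) (m≤n+o⇒m∸n≤o x c x≤))) (m⊓n+n∸m≡n c x)

-- Replace i by r₁ copies whose multiplicities are at most r₂ and add up to s i.
-- A large set T of copies gives i a multiplicity of at most r₁, so it contains
-- a monochromatic hyperedge for r₁; colour T accordingly and apply the bound for r₂.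
composite-bound : ∀ {q₁ q₂} → KneserBound (suc q₁) → KneserBound (suc q₂) → KneserBound (suc q₂ * suc q₁)
composite-bound {q₁} {q₂} bound₁ bound₂ {n} {m} k s s≤r col bound =
  assemble (bound₂ K copies copies≤ outer-col outer-bound)
  where
  r₁ r₂ K : ℕ
  r₁ = suc q₁
  r₂ = suc q₂
  -- `suc K` is the least total load for which the bound for `r₁` yields a hyperedge.
  K  = q₁ * m + r₁ * k

  copies : Fin (n * r₁) → ℕ
  copies x = piece r₂ r₁ (s (proj₁ (remQuot {n} r₁ x))) (proj₂ (remQuot {n} r₁ x))

  copies≤ : ∀ x → copies x ≤ r₂
  copies≤ x = piece≤ r₂ r₁ (s (proj₁ (remQuot {n} r₁ x))) (proj₂ (remQuot {n} r₁ x))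

  sum-copies : ∀ i → sumFin r₁ (λ a → copies (combine i a)) ≡ s i
  sum-copies i = trans
    (sumFin-cong λ a → cong (λ x → piece r₂ r₁ (s (proj₁ x)) (proj₂ x)) (Fin.remQuot-combine {n} {r₁} i a))
    (sum-piece r₂ r₁ (s i) (≤-trans (s≤r i) (≤-reflexive (*-comm r₂ r₁))))

  -- This choice of `K` makes the bound for `r₂` expand to the given one for the product.
  outer-bound : q₂ * m + r₂ * K < sumFin (n * r₁) copies
  outer-bound = subst₂ _<_ (expand q₁ q₂ m k) (sym (trans (sumFin-combine n copies) (sumFin-cong sum-copies))) bound
    where
    expand : ∀ q₁ q₂ m k → (q₁ + q₂ * suc q₁) * m + (suc q₂ * suc q₁) * k ≡ q₂ * m + suc q₂ * (q₁ * m + suc q₁ * k)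
    expand = solve-∀

  load : Subset (n * r₁) → Fin n → ℕ
  load T i = countTrue r₁ (λ a → lookup T (combine i a))

  inner : ∀ T → ∣ T ∣ ≡ suc K → Monochromatic r₁ (suc k) (load T) col
  inner T size = bound₁ k (load T) (λ i → countTrue≤n (λ a → lookup T (combine i a))) col
    (≤-reflexive (trans (sym size) (trans (∣∣≡countTrue T) (countTrue-combine n (lookup T)))))

  outer-col : Subset (n * r₁) → Fin m
  outer-col T with ∣ T ∣ ≟ suc K
  ... | yes size = proj₁ (proj₂ (inner T size))
  -- A default for sets of other sizes; the colour of the empty set is always available.
  ... | no  _    = col Subset.⊥

  inner-col : ∀ T → ∣ T ∣ ≡ suc K → Σ (Monochromatic r₁ (suc k) (load T) col) λ M → proj₁ (proj₂ M) ≡ outer-col T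
  inner-col T size with ∣ T ∣ ≟ suc K
  ... | yes size′ = inner T size′ , refl
  ... | no  ≢     = ⊥-elim (≢ size)

  assemble : Monochromatic r₂ (suc K) copies outer-col → Monochromatic (r₂ * r₁) (suc k) s col
  assemble (T , c , T-size , T-col , T-count) = A , c , size , colour , count
    where
    M : ∀ j → Σ (Monochromatic r₁ (suc k) (load (T j)) col) λ M → proj₁ (proj₂ M) ≡ outer-col (T j)
    M j = inner-col (T j) (T-size j)
    B : Fin r₂ → Fin r₁ → Subset n
    B j = proj₁ (proj₁ (M j))
    A : Fin (r₂ * r₁) → Subset n
    A x = B (proj₁ (remQuot {r₂} r₁ x)) (proj₂ (remQuot {r₂} r₁ x))
    size : ∀ x → ∣ A x ∣ ≡ suc k
    size x = proj₁ (proj₂ (proj₂ (proj₁ (M _)))) _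
    colour : ∀ x → col (A x) ≡ c
    colour x = trans (proj₁ (proj₂ (proj₂ (proj₂ (proj₁ (M _))))) _) (trans (proj₂ (M _)) (T-col _))
    count : ∀ i → countTrue (r₂ * r₁) (λ x → lookup (A x) i) ≤ s i
    count i = begin
      countTrue (r₂ * r₁) (λ x → lookup (A x) i)
        ≡⟨ countTrue-combine r₂ {r₁} (λ x → lookup (A x) i) ⟩
      sumFin r₂ (λ j → countTrue r₁ (λ l → lookup (A (combine j l)) i))
        ≡⟨ sumFin-cong (λ j → countTrue-cong λ l → cong (λ x → lookup (B (proj₁ x) (proj₂ x)) i) (Fin.remQuot-combine {r₂} {r₁} j l)) ⟩
      sumFin r₂ (λ j → countTrue r₁ (λ l → lookup (B j l) i))
        -- The sets found for `T j` use `i` at most as often as `T j` contains copies of `i`.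
        -- Summing copy by copy instead brings in the multiplicities of the copies.
        ≤⟨ sumFin-mono (λ j → proj₂ (proj₂ (proj₂ (proj₂ (proj₁ (M j))))) i) ⟩
      sumFin r₂ (λ j → countTrue r₁ (λ a → lookup (T j) (combine i a)))
        ≡⟨ sumFin-cong (λ j → countTrue≡sumFin (λ a → lookup (T j) (combine i a))) ⟩
      sumFin r₂ (λ j → sumFin r₁ (λ a → bit (lookup (T j) (combine i a))))
        ≡⟨ sumFin-swap (λ j a → bit (lookup (T j) (combine i a))) ⟩
      sumFin r₁ (λ a → sumFin r₂ (λ j → bit (lookup (T j) (combine i a))))
        ≡⟨ sumFin-cong (λ a → countTrue≡sumFin (λ j → lookup (T j) (combine i a))) ⟨
      sumFin r₁ (λ a → countTrue r₂ (λ j → lookup (T j) (combine i a)))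
        ≤⟨ sumFin-mono (λ a → T-count (combine i a)) ⟩
      sumFin r₁ (λ a → copies (combine i a))
        ≡⟨ sum-copies i ⟩
      s i ∎
      where open ≤-Reasoning

kneser-bound : ∀ r → 2 ≤ r → KneserBound r
kneser-bound = <-rec (λ r → 2 ≤ r → KneserBound r) step
  where
  step : ∀ r → (∀ {r′} → r′ < r → 2 ≤ r′ → KneserBound r′) → 2 ≤ r → KneserBound r
  step r rec 2≤r with prime? r
  ... | yes isPrime = prime-bound isPrime
  ... | no ¬prime with ¬prime⇒composite {{n>1⇒nonTrivial 2≤r}} ¬prime
  ...   | composite {zero} _ 0∣r = ⊥-elim (n≮0 (subst (1 <_) (0∣⇒≡0 0∣r) 2≤r))
  ...   | composite {suc d} d<r d∣r@(divides zero    eq) = ⊥-elim (n≮0 (subst (1 <_) eq 2≤r))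
  ...   | composite {suc d} d<r d∣r@(divides (suc e) eq) = let instance _ = >-nonZero (<⇒≤ 2≤r) in subst KneserBound (sym eq)
    (composite-bound (rec d<r (nonTrivial⇒n>1 (suc d)))
                     (rec (quotient-< d∣r) (quotient>1 d∣r d<r)))

-- b r ≤ r

-- True for any fuel: running out of it only lowers the exponent.
mult-∣ : ∀ f p m → p ^ mult f p m ∣ m
mult-∣ zero    p             m       = 1∣ m
mult-∣ (suc f) zero          m       = 1∣ m
mult-∣ (suc f) (suc zero)    m       = 1∣ m
mult-∣ (suc f) (suc (suc q)) zero    = 1∣ 0
mult-∣ (suc f) (suc (suc q)) (suc m) with suc (suc q) ∣? suc m
... | yes p∣m = subst (suc (suc q) ^ suc (mult f (suc (suc q)) (suc m / suc (suc q))) ∣_) (m*[n/m]≡n p∣m)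
  (*-monoʳ-∣ (suc (suc q)) (mult-∣ f (suc (suc q)) (suc m / suc (suc q))))
... | no  _   = 1∣ suc m

module _ {p : ℕ} (isPrime : Prime p) where

  prime-∣-^ : ∀ {a} e → p ∣ a ^ e → p ∣ a
  prime-∣-^     zero    p∣1 = ⊥-elim (¬prime[1] (subst Prime (∣1⇒≡1 p∣1) isPrime))
  prime-∣-^ {a} (suc e) p∣  with euclidsLemma a (a ^ e) isPrime p∣
  ... | inj₁ p∣a = p∣a
  ... | inj₂ p∣  = prime-∣-^ e p∣

  -- Euclid's lemma finds one factor `p` at a time in `x`.
  ^-∣-cancel : ∀ {c x} e → ¬ p ∣ c → p ^ e ∣ c * x → p ^ e ∣ x
  ^-∣-cancel         zero    p∤c _  = 1∣ _
  ^-∣-cancel {c} {x} (suc e) p∤c p∣ with euclidsLemma c x isPrime (∣-trans (m∣m*n (p ^ e)) p∣)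
  ... | inj₁ p∣c             = ⊥-elim (p∤c p∣c)
  ... | inj₂ (divides y refl) = subst (p * p ^ e ∣_) (*-comm p y) (*-monoʳ-∣ p (^-∣-cancel e p∤c
          (*-cancelˡ-∣ p {{prime⇒nonZero isPrime}} (subst (p * p ^ e ∣_) (rearrange c y p) p∣))))
    where
    rearrange : ∀ c y p → c * (y * p) ≡ p * (c * y)
    rearrange = solve-∀

module _ (r : ℕ) where

  primePart : ℕ → ℕ
  primePart p = if does (prime? p) then p ^ mult r p r else 1

  prime-∤-primeParts : ∀ {p} → Prime p → ∀ {L} → All (p ≢_) L → ¬ p ∣ product (map primePart L)
  prime-∤-primeParts isPrime []            p∣1 = ¬prime[1] (subst Prime (∣1⇒≡1 p∣1) isPrime)
  prime-∤-primeParts isPrime (_∷_ {l} {L} p≢l p≢L) p∣ with euclidsLemma (primePart l) _ isPrime p∣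
  ... | inj₂ p∣L = prime-∤-primeParts isPrime p≢L p∣L
  ... | inj₁ p∣l with prime? l
  ...   | no  _  = ¬prime[1] (subst Prime (∣1⇒≡1 p∣l) isPrime)
  ...   | yes l-prime with prime⇒irreducible l-prime (prime-∣-^ isPrime (mult r l r) p∣l)
  ...     | inj₁ refl = ¬prime[1] isPrime
  ...     | inj₂ p≡l  = p≢l p≡l

  -- If `r` is `x` times the parts already collected, the next prime power divides `r`, is coprime
  -- to those parts and so divides `x`.
  primeParts-∣ : ∀ {L} → Unique L → product (map primePart L) ∣ r
  primeParts-∣ []            = 1∣ r
  primeParts-∣ {l ∷ L} (l≢L ∷ unique) with prime? l | primeParts-∣ unique
  ... | no  _     | L∣r              = subst (_∣ r) (sym (*-identityˡ _)) L∣r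
  ... | yes isPrime | divides x r≡xL = subst (l ^ mult r l r * product (map primePart L) ∣_) (sym r≡xL)
    (*-monoˡ-∣ (product (map primePart L))
    (^-∣-cancel isPrime (mult r l r) (prime-∤-primeParts isPrime l≢L)
      (subst (l ^ mult r l r ∣_) (trans r≡xL (*-comm x _)) (mult-∣ r l r))))

  -- Replacing every weight by the prime itself can only increase the product, and the result
  -- divides `r`.
  b≤ : .{{NonZero r}} → b r ≤ r
  b≤ = ≤-trans (product-mono (upTo (suc r))) (∣⇒≤ (primeParts-∣ (upTo⁺ (suc r))))
    where
    primeWeight≤ : ∀ p → primeWeight p ≤ p
    primeWeight≤ p with does (p ≟ 2) in eq
    ... | true  = ≤-reflexive (sym (does⇒ (p ≟ 2) eq))
    ... | false = m∸n≤m p 1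
    term≤ : ∀ p → (if does (prime? p) then primeWeight p ^ mult r p r else 1) ≤ primePart p
    term≤ p with prime? p
    ... | yes _ = ^-monoˡ-≤ (mult r p r) (primeWeight≤ p)
    ... | no  _ = ≤-refl
    product-mono : ∀ L → product (map (λ p → if does (prime? p) then primeWeight p ^ mult r p r else 1) L) ≤ product (map primePart L)
    product-mono []      = ≤-refl
    product-mono (p ∷ L) = *-mono-≤ (term≤ p) (product-mono L)

-- From monochromatic hyperedges to the chromatic number

ceilDiv-≤ : ∀ a d m → ¬ (d * m < a) → ceilDiv a d ≤ m
ceilDiv-≤ a zero    m h = z≤n
ceilDiv-≤ a (suc d) m h = s≤s⁻¹ (m<n*o⇒m/o<n {a + d} {suc m} {suc d} (begin-strict
  a + d                    <⟨ +-monoʳ-< a (n<1+n d) ⟩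
  a + suc d                ≤⟨ +-monoˡ-≤ (suc d) (≮⇒≥ h) ⟩
  suc d * m + suc d        ≡⟨ regroup d m ⟩
  suc m * suc d            ∎))
  where
  open ≤-Reasoning
  regroup : ∀ d m → suc d * m + suc d ≡ suc m * suc d
  regroup = solve-∀

chromatic-bound : ∀ r k n → 2 ≤ r → (s : Fin n → ℕ) → (∀ i → s i ≤ r) →
                  ChromaticAtLeast r n (suc k) s (ceilDiv (sumFin n s ∸ r * k) (r ∸ 1))
chromatic-bound r k n 2≤r s s≤r m c proper = ceilDiv-≤ _ (r ∸ 1) m λ large →
  let bound = exceeds large
      (A , a , size , colour , count) = kneser-bound r 2≤r k s s≤r (col bound) bound
      c-colour = λ j → trans (sym (col-c bound (A j) (size j))) (colour j)
  in proper (λ j → A j , size j) count λ j j′ → trans (c-colour j) (sym (c-colour j′))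
  where
  exceeds : (r ∸ 1) * m < sumFin n s ∸ r * k → (r ∸ 1) * m + r * k < sumFin n s
  exceeds h with r * k ≤? sumFin n s
  ... | yes rk≤ = m≤o∸n⇒m+n≤o (suc ((r ∸ 1) * m)) rk≤ h
  -- If the subtraction truncates to 0, nothing lies strictly below it.
  ... | no  rk≰ = ⊥-elim (n≮0 (subst ((r ∸ 1) * m <_) (m≤n⇒m∸n≡0 (≰⇒≥ rk≰)) h))

  module _ (bound : (r ∸ 1) * m + r * k < sumFin n s) where

    -- Ensures that there is a vertex, whose colour serves as the default in `col`.
    k<n : k < n
    k<n = *-cancelˡ-< r k n (begin-strict
      r * k                    ≤⟨ m≤n+m (r * k) _ ⟩
      (r ∸ 1) * m + r * k      <⟨ bound ⟩
      sumFin n s               ≤⟨ sumFin-mono s≤r ⟩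
      sumFin n (λ _ → r)       ≡⟨ sumFin-const n r ⟩
      n * r                    ≡⟨ *-comm n r ⟩
      r * n                    ∎)
      where open ≤-Reasoning

    some-vertex : Vertex n (suc k)
    some-vertex with subset-of-size (suc k) (λ _ → true) (subst (suc k ≤_) (sym (countTrue-true n)) k<n)
    ... | B , size , _ = B , size

    col : Subset n → Fin m
    col B with ∣ B ∣ ≟ suc k
    ... | yes size = c (B , size)
    ... | no  _    = c some-vertex

    col-c : ∀ B (size : ∣ B ∣ ≡ suc k) → col B ≡ c (B , size)
    col-c B size with ∣ B ∣ ≟ suc k
    -- Proofs of equalities in ℕ are unique, so `c` cannot depend on which proof of the size it
    -- receives.
    ... | yes size′ = cong (λ e → c (B , e)) (≡-irrelevant size′ size)
    ... | no  ≢     = ⊥-elim (≢ size)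

theorem3p7 : (r k n : ℕ) → 2 ≤ r → 1 ≤ k → 1 ≤ n →
    ((s : Fin n → ℕ) → ((i : Fin n) → 1 ≤ s i × s i ≤ b r ∸ 1) →
    ChromaticAtLeast r n k s (ceilDiv (sumFin n s ∸ r * (k ∸ 1)) (r ∸ 1)))
    × ((s : ℕ) → 1 ≤ s ∸ 1 → s ∸ 1 ≤ b r ∸ 1 →
    ChromaticAtLeast r n k (λ _ → s ∸ 1) (ceilDiv ((s ∸ 1) * n ∸ r * (k ∸ 1)) (r ∸ 1)))
theorem3p7 r (suc k) n 2≤r _ _ =
  (λ s hyp → chromatic-bound r k n 2≤r s (λ i → ≤-trans (proj₂ (hyp i)) b-1≤r)) ,
  (λ s _ s-1≤b-1 → subst (λ x → ChromaticAtLeast r n (suc k) (λ _ → s ∸ 1) (ceilDiv (x ∸ r * k) (r ∸ 1)))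
                     (trans (sumFin-const n (s ∸ 1)) (*-comm n (s ∸ 1)))
                     (chromatic-bound r k n 2≤r (λ _ → s ∸ 1) (λ _ → ≤-trans s-1≤b-1 b-1≤r)))
  where
  b-1≤r : b r ∸ 1 ≤ r
  b-1≤r = ≤-trans (m∸n≤m (b r) 1) (b≤ r {{>-nonZero (<⇒≤ 2≤r)}})
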